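{- Let $s\ge 2$, $t\ge 2$ and $n=s+t-1$. The graph $K^{s,t}_{n}$ is determined by its $D$-spectrum: every connected graph $D$-cospectral to $K^{s,t}_{n}$ is isomorphic to $K^{s,t}_{n}$.
   Context: All graphs are simple, undirected and connected. For a connected graph $G$, the distance matrix $D(G)$ has as $(i,j)$-entry the distance between the $i$-th and $j$-th vertices; its eigenvalues form the $D$-spectrum of $G$. Two graphs are $D$-cospectral if they have the same $D$-spectrum; $G$ is determined by its $D$-spectrum if every graph $D$-cospectral to $G$ is isomorphic to $G$. $K^{s,t}_{n}$ denotes the graph obtained from disjoint copies of $K_s$ and $K_t$ by identifying a vertex of $K_s$ with a vertex of $K_t$. -}

module Defs where

open import Algebra.Apartness.Bundles using (HeytingField; module HeytingCommutativeRing)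
open import Algebra.Bundles using (CommutativeRing; Semiring)
import Algebra.Definitions.RawSemiring as RawSemiringDefs
open import Data.Bool.Base using (if_then_else_)
open import Data.Fin.Base using (Fin; zero; suc; toℕ; fromℕ<; punchIn)
open import Data.Fin.Properties using (any?; toℕ-fromℕ<; toℕ<n) renaming (_≟_ to _≟ᶠ_)
open import Data.List.Base using (List; length; foldr; map)
import Data.List.Relation.Binary.Permutation.Setoid as Permutation
open import Data.Nat.Base using (ℕ; zero; suc; _∸_; _<_; _≤_; z≤n; s≤s⁻¹) renaming (_+_ to _+ℕ_)
open import Data.Nat.Properties using (_<?_; _≤?_; ≤-refl; ≤-<-trans; ≮⇒≥; m≤n⇒m≤1+n)
open import Data.Product.Base using (∃-syntax; _×_; _,_; swap)
open import Data.Sum.Base as Sum using (_⊎_; inj₁; inj₂)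
open import Function.Base using (_∘_)
open import Function.Bundles using (_↔_; _⇔_; Inverse)
open import Level using (Level; 0ℓ; _⊔_)
open import Relation.Binary.Core using (Rel)
import Relation.Binary.Definitions as B
open import Relation.Binary.PropositionalEquality.Core using (_≡_; _≢_; refl; sym; subst)
open import Relation.Nullary.Decidable using (Dec; yes; no; does; _×-dec_; _⊎-dec_; ¬?)
open import Relation.Nullary.Negation using (¬_)
open import Relation.Unary using (Pred; Decidable)

-- A walk with exactly k edges.
Walk : ∀ {n} → Rel (Fin n) 0ℓ → ℕ → Rel (Fin n) 0ℓ
Walk _∼_ zero    u v = u ≡ v
Walk _∼_ (suc k) u v = ∃[ w ] (u ∼ w × Walk _∼_ k w v)

record ConnectedGraph (n : ℕ) : Set₁ where
  infix 4 _∼_ _∼?_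
  field
    _∼_       : Rel (Fin n) 0ℓ
    _∼?_      : B.Decidable _∼_
    ∼-sym     : B.Symmetric _∼_
    ∼-irrefl  : ∀ {u} → ¬ (u ∼ u)
    connected : ∀ u v → ∃[ k ] Walk _∼_ k u v

  walk? : ∀ k u v → Dec (Walk _∼_ k u v)
  walk? zero    u v = u ≟ᶠ v
  walk? (suc k) u v = any? λ w → (u ∼? w) ×-dec walk? k w v

-- The least number satisfying P, searched from 0 upwards; the witness n
-- only bounds the search.
least : ∀ {P : Pred ℕ 0ℓ} → Decidable P → ∀ n → P n → ℕ
least P? zero    _ = 0
least P? (suc n) p = if does (P? 0) then 0 else suc (least (P? ∘ suc) n p)

module _ {n : ℕ} (G : ConnectedGraph n) where
  open ConnectedGraph G

  distance : Fin n → Fin n → ℕ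
  distance u v = let (k , walk) = connected u v in least (λ j → walk? j u v) k walk

record _≅_ {m n : ℕ} (G : ConnectedGraph m) (H : ConnectedGraph n) : Set where
  private
    module G = ConnectedGraph G
    module H = ConnectedGraph H
  field
    bijection : Fin m ↔ Fin n
  open Inverse bijection using (to)
  field
    adjacency : ∀ u v → (u G.∼ v) ⇔ (to u H.∼ to v)

-- K^{s,t}, on s + t - 1 vertices. The copy of K_s lives on the vertices 0, …, s-1 and the copy of K_t on
-- s-1, …, s+t-2, so that s-1 is the identified vertex. The condition
-- s-1 ≤ i is written s ≤ suc i.
module Coalescence (s t : ℕ) where

  V : Set
  V = Fin (s +ℕ t ∸ 1)

  InKₛ InKₜ : Pred V 0ℓ
  InKₛ i = toℕ i < s
  InKₜ i = s ≤ suc (toℕ i)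

  _∼ₖ_ : Rel V 0ℓ
  i ∼ₖ j = i ≢ j × ((InKₛ i × InKₛ j) ⊎ (InKₜ i × InKₜ j))

  _∼ₖ?_ : B.Decidable _∼ₖ_
  i ∼ₖ? j = ¬? (i ≟ᶠ j) ×-dec
    (((toℕ i <? s) ×-dec (toℕ j <? s)) ⊎-dec ((s ≤? suc (toℕ i)) ×-dec (s ≤? suc (toℕ j))))

  ∼ₖ-sym : B.Symmetric _∼ₖ_
  ∼ₖ-sym (i≢j , e) = i≢j ∘ sym , Sum.map swap swap e

  -- An edge or the trivial walk.
  step : ∀ i j → (InKₛ i × InKₛ j) ⊎ (InKₜ i × InKₜ j) → ∃[ k ] Walk _∼ₖ_ k i j
  step i j e with i ≟ᶠ j
  ... | yes i≡j = 0 , i≡j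
  ... | no  i≢j = 1 , j , (i≢j , e) , refl

  concat : ∀ k l {i j m} → Walk _∼ₖ_ k i j → Walk _∼ₖ_ l j m → Walk _∼ₖ_ (k +ℕ l) i m
  concat zero    l refl        q = q
  concat (suc k) l (w , e , p) q = w , e , concat k l p q

  -- The identified vertex s-1.
  cross : ∀ i j → InKₛ i → InKₜ j → ∃[ c ] (InKₛ c × InKₜ c)
  cross i j i<s s≤j = c , subst (_< s) (sym c≡) lt , subst (λ x → s ≤ suc x) (sym c≡) ge
    where
    pred-lt : ∀ {x y} → x < y → y ∸ 1 < y
    pred-lt {y = suc y} _ = ≤-refl
    pred-le : ∀ {x} y → y ≤ suc x → y ∸ 1 ≤ x
    pred-le zero    _ = z≤n
    pred-le (suc y) p = s≤s⁻¹ p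
    pred-ge : ∀ y → y ≤ suc (y ∸ 1)
    pred-ge zero    = z≤n
    pred-ge (suc y) = ≤-refl
    bound : s ∸ 1 < s +ℕ t ∸ 1
    bound = ≤-<-trans (pred-le s s≤j) (toℕ<n j)
    c : V
    c = fromℕ< bound
    c≡ : toℕ c ≡ s ∸ 1
    c≡ = toℕ-fromℕ< bound
    lt : s ∸ 1 < s
    lt = pred-lt i<s
    ge : s ≤ suc (s ∸ 1)
    ge = pred-ge s

  ∼ₖ-connected : ∀ i j → ∃[ k ] Walk _∼ₖ_ k i j
  ∼ₖ-connected i j with toℕ i <? s | toℕ j <? s
  ... | yes i<s | yes j<s = step i j (inj₁ (i<s , j<s))
  ... | no  i≮s | no  j≮s =
    step i j (inj₂ (m≤n⇒m≤1+n (≮⇒≥ i≮s) , m≤n⇒m≤1+n (≮⇒≥ j≮s)))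
  ... | yes i<s | no  j≮s =
    let s≤j             = m≤n⇒m≤1+n (≮⇒≥ j≮s)
        (c , c<s , s≤c) = cross i j i<s s≤j
        (k , p)         = step i c (inj₁ (i<s , c<s))
        (l , q)         = step c j (inj₂ (s≤c , s≤j))
    in k +ℕ l , concat k l p q
  ... | no  i≮s | yes j<s =
    let s≤i             = m≤n⇒m≤1+n (≮⇒≥ i≮s)
        (c , c<s , s≤c) = cross j i j<s s≤i
        (k , p)         = step i c (inj₂ (s≤i , s≤c))
        (l , q)         = step c j (inj₁ (c<s , j<s))
    in k +ℕ l , concat k l p q

  K^ : ConnectedGraph (s +ℕ t ∸ 1)
  K^ = record
    { _∼_       = _∼ₖ_
    ; _∼?_      = _∼ₖ?_
    ; ∼-sym     = ∼ₖ-sym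
    ; ∼-irrefl  = λ (i≢i , _) → i≢i refl
    ; connected = ∼ₖ-connected
    }

open Coalescence public using (K^)

module Determinant {c ℓ : Level} (R : CommutativeRing c ℓ) where
  open CommutativeRing R using (Carrier; _*_; _-_; -_; 0#; 1#; semiring)
  open RawSemiringDefs (Semiring.rawSemiring semiring) public using (sum; _^_) renaming (_×_ to _·_)

  Matrix : ℕ → Set c
  Matrix n = Fin n → Fin n → Carrier

  -- Laplace expansion along the first row.
  det : ∀ {n} → Matrix n → Carrier
  det {zero}  A = 1#
  det {suc n} A =
    sum λ j → ((- 1#) ^ toℕ j) * (A zero j * det (λ i k → A (suc i) (punchIn j k)))

  identity : ∀ {n} → Matrix n
  identity i j = if does (i ≟ᶠ j) then 1# else 0#

  characteristic : ∀ {n} → Matrix n → Carrier → Carrier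
  characteristic A x = det λ i j → x * identity i j - A i j

-- The stdlib has no real numbers, so the eigenvalues are taken in an
-- arbitrary field K of characteristic 0; K = ℝ is the intended case.
module _ {c ℓ₁ ℓ₂ : Level} (K : HeytingField c ℓ₁ ℓ₂) where
  open HeytingField K using (Carrier; _≈_; _*_; _-_; 1#; 0#; heytingCommutativeRing)
  open HeytingCommutativeRing heytingCommutativeRing using (commutativeRing)
  open CommutativeRing commutativeRing using (setoid)
  open Determinant commutativeRing
  open Permutation setoid using (_↭_)

  CharacteristicZero : Set ℓ₁
  CharacteristicZero = ∀ k → (k · 1#) ≈ 0# → k ≡ 0

  D : ∀ {n} → ConnectedGraph n → Matrix n
  D G i j = distance G i j · 1#

  -- λs lists the eigenvalues of A with multiplicity: there are n of them and
  -- det (x I - A) = ∏ (x - λᵢ). Over the (infinite) fields of characteristic 0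
  -- this identity of functions amounts to the identity of polynomials.
  IsSpectrum : ∀ {n} → Matrix n → List Carrier → Set (c ⊔ ℓ₁)
  IsSpectrum {n} A λs =
    length λs ≡ n × (∀ x → characteristic A x ≈ foldr _*_ 1# (map (x -_) λs))

  DCospectral : ∀ {m n} → ConnectedGraph m → ConnectedGraph n → Set (c ⊔ ℓ₁)
  DCospectral G H =
    ∃[ λs ] ∃[ μs ] (IsSpectrum (D G) λs × IsSpectrum (D H) μs × λs ↭ μs)

  DeterminedByDSpectrum : ∀ {n} → ConnectedGraph n → Set (Level.suc 0ℓ ⊔ c ⊔ ℓ₁)
  DeterminedByDSpectrum G = ∀ {m} (H : ConnectedGraph m) → DCospectral H G → H ≅ G

{-# OPTIONS --safe #-}

-- Let M = D + I. The characteristic polynomial determines det (I - yM) and hence, by Newton's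
-- identities, the traces of all powers of M. By Cauchy–Binet, the sum of the squares of the 4 × 4
-- minors of a symmetric matrix is a polynomial in these traces; it vanishes for K^{s,t}, whose M
-- has only three distinct rows, so every 4 × 4 minor of M(H) vanishes. This forbids isometric paths
-- on four vertices, so H has diameter at most 2, and a few induced subgraphs of the graph
-- "at distance 2", which must then be a complete bipartite graph on p + q vertices together with
-- r isolated vertices. Finally tr M² = n² + 6pq and tr M³ = n³ + 9npq - 3pqr determine r and {p, q}.
module Submission where

open import Defs
open import Algebra.Apartness.Bundles using (HeytingField; module HeytingCommutativeRing)
open import Algebra.Bundles using (CommutativeRing)
import Algebra.Properties.CommutativeSemigroup as CommutativeSemigroupProperties
import Algebra.Properties.Ring as RingProperties
import Algebra.Properties.Semiring.Mult as SemiringMult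
import Algebra.Properties.Semiring.Sum
import Algebra.Solver.Ring.NaturalCoefficients.Default as SemiringSolver
open import Data.Bool.Base using (if_then_else_)
open import Data.Fin.Base using (Fin; zero; suc; toℕ; fromℕ; punchIn; punchOut)
open import Data.Fin.Properties as Fin using (punchIn-punchOut; pigeonhole) renaming (_≟_ to _≟ᶠ_)
import Data.Fin.Permutation as Perm
open import Data.Integer.Base using (ℤ; +_; -[1+_]; 0ℤ; 1ℤ; -1ℤ; _+_; _*_; -_; _-_; ∣_∣)
import Data.Integer.Properties as ℤ
open import Data.Integer.Tactic.RingSolver using (solve-∀)
open import Data.List.Base using (List; foldr; map)
import Data.List.Relation.Binary.Permutation.Homogeneous as Permutation
import Data.List.Relation.Binary.Permutation.Setoid.Properties as PermutationProperties
open import Data.Nat.Base as ℕ using (ℕ; zero; suc; _!; _≤_; z≤n; s≤s)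
import Data.Nat.Properties as ℕ
open import Data.Product.Base using (∃-syntax; _×_; _,_; proj₁; proj₂)
open import Data.Sum.Base using (_⊎_; inj₁; inj₂)
open import Data.Vec.Functional using (Vector; _∷_; []; head; tail)
open import Function.Base using (_∘_)
open import Function.Bundles using (mk⇔; Injection)
open import Function.Properties.Inverse using (↔⇒↣)
open import Level using (Level)
open import Relation.Binary.PropositionalEquality
  using (_≡_; _≢_; refl; sym; trans; cong; cong₂; subst; subst₂; _≗_; module ≡-Reasoning)
import Relation.Binary.Reasoning.Setoid as SetoidReasoning
open import Relation.Nullary.Decidable using (Dec; yes; no; does; decidable-stable)
open import Relation.Nullary.Negation using (¬_; contradiction)

-- Adding I to D makes the diagonal agree with the entry for adjacent vertices, so two vertices of
-- `K^{s,t}` in the same class have identical rows; this is what brings the rank down to at most 3.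
-- The obstacle is the field: a Heyting field of characteristic 0 has neither an order nor a
-- spectral theorem, so arguments by interlacing or diagonalisation are out of reach. Positivity is
-- available in ℤ. Hence the equality of characteristic polynomials is carried over to ℤ as an
-- equality of integer values det (I - yM) at integers y, and derivatives and constant terms are
-- read off from congruences modulo all positive integers instead of from coefficients. The matrix
-- M² appears because sums of principal minors of M itself mix signs and may cancel, whereas the
-- principal minors of M² are sums of squares of minors of M; a vanishing total then forces each
-- single minor to vanish.

open ≡-Reasoning
open Determinant ℤ.+-*-commutativeRing using (Matrix; det; identity; sum; _^_)
private module Sum = Algebra.Properties.Semiring.Sum ℤ.+-*-semiring

-- Opaque, so that Agda infers f from ∑ f instead of unfolding the sum.
opaque
  ∑ : ∀ {n} → (Fin n → ℤ) → ℤ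
  ∑ = sum

  ∑-nil : {f : Fin 0 → ℤ} → ∑ f ≡ 0ℤ
  ∑-nil = refl

  ∑-suc : ∀ {n} {f : Fin (suc n) → ℤ} → ∑ f ≡ f zero + ∑ (f ∘ suc)
  ∑-suc = refl

  ∑-cong : ∀ {n} {f g : Fin n → ℤ} → (∀ i → f i ≡ g i) → ∑ f ≡ ∑ g
  ∑-cong = Sum.sum-cong-≗

  ∑-zero : ∀ {n} {f : Fin n → ℤ} → (∀ i → f i ≡ 0ℤ) → ∑ f ≡ 0ℤ
  ∑-zero {n} f≡0 = trans (Sum.sum-cong-≗ f≡0) (Sum.sum-replicate-zero n)

  ∑-*ˡ : ∀ {n} x (f : Fin n → ℤ) → ∑ (λ i → x * f i) ≡ x * ∑ f
  ∑-*ˡ x f = sym (Sum.*-distribˡ-sum x f)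

  ∑-*ʳ : ∀ {n} x (f : Fin n → ℤ) → ∑ (λ i → f i * x) ≡ ∑ f * x
  ∑-*ʳ x f = sym (Sum.*-distribʳ-sum x f)

  ∑-+ : ∀ {n} (f g : Fin n → ℤ) → ∑ (λ i → f i + g i) ≡ ∑ f + ∑ g
  ∑-+ = Sum.∑-distrib-+

  ∑-comm : ∀ {m n} (f : Fin m → Fin n → ℤ) → ∑ (λ i → ∑ (f i)) ≡ ∑ (λ j → ∑ λ i → f i j)
  ∑-comm = Sum.∑-comm

  ∑-remove : ∀ {n} (i : Fin (suc n)) (f : Fin (suc n) → ℤ) → ∑ f ≡ f i + ∑ (f ∘ punchIn i)
  ∑-remove i f = Sum.sum-remove {i = i} f

∑-single : ∀ {n} (i : Fin (suc n)) {f : Fin (suc n) → ℤ} → (∀ j → f (punchIn i j) ≡ 0ℤ) → ∑ f ≡ f i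
∑-single i {f} f≡0 = trans (∑-remove i f) (trans (cong (_+_ (f i)) (∑-zero f≡0)) (ℤ.+-identityʳ (f i)))

∑-linear : ∀ {n} x (f g : Fin n → ℤ) → ∑ (λ i → f i + x * g i) ≡ ∑ f + x * ∑ g
∑-linear x f g = trans (∑-+ f (λ i → x * g i)) (cong (_+_ (∑ f)) (∑-*ˡ x g))

sign : ∀ {n} → Fin n → ℤ
sign i = -1ℤ ^ toℕ i

sign² : ∀ {n} (i : Fin n) → sign i * sign i ≡ 1ℤ
sign² zero    = refl
sign² (suc i) = trans (square (sign i)) (sign² i)
  where
  square : ∀ s → (-1ℤ * s) * (-1ℤ * s) ≡ s * s
  square = solve-∀

-- Rectangular arrays and the insertion of a row

Rows : ℕ → ℕ → Set
Rows k m = Fin k → Fin m → ℤ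

infix 4 _≐_
_≐_ : ∀ {k m} → Rows k m → Rows k m → Set
X ≐ Y = ∀ i j → X i j ≡ Y i j

module _ {a} {A : Set a} where

  -- Inverse to deleting entry `i` with `punchIn i`. Bringing row `i` of a matrix to the front
  -- becomes a passage from `insert i x X` to `x ∷ X`.
  insert : ∀ {k} → Fin (suc k) → A → Vector A k → Vector A (suc k)
  insert         zero    x X = x ∷ X
  insert {suc _} (suc i) x X = head X ∷ insert i x (tail X)

  insert-lookup : ∀ {k} (i : Fin (suc k)) {x} {X : Vector A k} → insert i x X i ≡ x
  insert-lookup         zero    = refl
  insert-lookup {suc _} (suc i) = insert-lookup i

  insert-punchIn : ∀ {k} (i : Fin (suc k)) {x} {X : Vector A k} → insert i x X ∘ punchIn i ≗ X
  insert-punchIn         zero    j       = refl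
  insert-punchIn {suc _} (suc i) zero    = refl
  insert-punchIn {suc _} (suc i) (suc j) = insert-punchIn i j

  insert-remove : ∀ {k} (i : Fin (suc k)) (X : Vector A (suc k)) →
    insert i (X i) (X ∘ punchIn i) ≗ X
  insert-remove         zero    X zero    = refl
  insert-remove         zero    X (suc j) = refl
  insert-remove {suc _} (suc i) X zero    = refl
  insert-remove {suc _} (suc i) X (suc j) = insert-remove i (tail X) j

map-insert : ∀ {a b} {A : Set a} {B : Set b} (f : A → B) {k} (i : Fin (suc k)) {x} {X : Vector A k} →
  f ∘ insert i x X ≗ insert i (f x) (f ∘ X)
map-insert f         zero    zero    = refl
map-insert f         zero    (suc j) = refl
map-insert f {suc _} (suc i) zero    = refl
map-insert f {suc _} (suc i) (suc j) = map-insert f i j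

-- Determinants

minor : ∀ {k m} → Fin (suc m) → Rows k (suc m) → Rows k m
minor j X i k = X i (punchIn j k)

opaque
  unfolding ∑

  -- An opaque copy of `det`: the general theory uses only `det-nil` and `det-expand`, and `Det≡det`
  -- leads back to `det` where explicit minors have to compute or images in the field are taken.
  Det : ∀ {n} → Matrix n → ℤ
  Det = det

  Det≡det : ∀ {n} (A : Matrix n) → Det A ≡ det A
  Det≡det A = refl

  det-nil : (A : Matrix 0) → Det A ≡ 1ℤ
  det-nil A = refl

  det-expand : ∀ {n} (A : Matrix (suc n)) →
    Det A ≡ ∑ λ j → sign j * (A zero j * Det (minor j (tail A)))
  det-expand A = refl

det-cong : ∀ {n} {A B : Matrix n} → A ≐ B → Det A ≡ Det B
det-cong {zero}  {A} {B} A≐B = trans (det-nil A) (sym (det-nil B))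
det-cong {suc n} {A} {B} A≐B = begin
  Det A
    ≡⟨ det-expand A ⟩
  ∑ (λ j → sign j * (A zero j * Det (minor j (tail A))))
    ≡⟨ ∑-cong (λ j → cong (_*_ (sign j)) (cong₂ _*_ (A≐B zero j) (det-cong λ i k → A≐B (suc i) (punchIn j k)))) ⟩
  ∑ (λ j → sign j * (B zero j * Det (minor j (tail B))))
    ≡⟨ det-expand B ⟨
  Det B ∎

-- The double Laplace expansion along two rows a and b, where h abstracts the complementary minors;
-- h is a function of the embedding of the remaining columns.
det₂ : ∀ {n} → Vector ℤ (suc (suc n)) → Vector ℤ (suc (suc n)) → ((Fin n → Fin (suc (suc n))) → ℤ) → ℤ
det₂ a b h = ∑ λ j → sign j * (a j * ∑ λ k → sign k * (b (punchIn j k) * h (punchIn j ∘ punchIn k)))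

-- Split the pairs of columns by whether `a` takes column zero, `b` takes it, or neither does.
-- Interchanging `a` and `b` exchanges the first two families with opposite signs. In the third,
-- column zero stays among the remaining columns, and the sum is again a double expansion with one
-- column fewer. The hypothesis on `h` stands in for function extensionality.
det₂-swap : ∀ {n} a b (h : (Fin n → Fin (suc (suc n))) → ℤ) → (∀ {e e′} → e ≗ e′ → h e ≡ h e′) →
  det₂ a b h ≡ - det₂ b a h
det₂-swap {n} a b h h-cong = begin
  det₂ a b h
    ≡⟨ expand a b ⟩
  a zero * E b + (- (b zero * E a) + T a b)
    ≡⟨ cong (λ z → a zero * E b + (- (b zero * E a) + z)) (T-swap n refl) ⟩
  a zero * E b + (- (b zero * E a) + - T b a)
    ≡⟨ regroup (a zero * E b) (b zero * E a) (T b a) ⟩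
  - (b zero * E a + (- (a zero * E b) + T b a))
    ≡⟨ cong -_ (expand b a) ⟨
  - det₂ b a h ∎
  where
  regroup : ∀ x y z → x + (- y + - z) ≡ - (y + (- x + z))
  regroup = solve-∀
  split : ∀ s x y z w → (-1ℤ * s) * (x * (1ℤ * (y * z) + w)) ≡ - y * (s * (x * z)) + (-1ℤ * s) * (x * w)
  split = solve-∀
  E : Vector ℤ (suc (suc n)) → ℤ
  E b = ∑ λ k → sign k * (b (suc k) * h (suc ∘ punchIn k))
  S : Vector ℤ (suc (suc n)) → Fin (suc n) → ℤ
  S b j = ∑ λ k → (-1ℤ * sign k) * (b (suc (punchIn j k)) * h (punchIn (suc j) ∘ punchIn (suc k)))
  T : Vector ℤ (suc (suc n)) → Vector ℤ (suc (suc n)) → ℤ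
  T a b = ∑ λ j → (-1ℤ * sign j) * (a (suc j) * S b j)
  expand : ∀ a b → det₂ a b h ≡ a zero * E b + (- (b zero * E a) + T a b)
  expand a b = trans ∑-suc (cong₂ _+_ (ℤ.*-identityˡ (a zero * E b)) (begin
    ∑ (λ j → (-1ℤ * sign j) * (a (suc j) * ∑ (λ k → sign k * (b (punchIn (suc j) k) * h (punchIn (suc j) ∘ punchIn k)))))
      ≡⟨ ∑-cong (λ j → cong (λ z → (-1ℤ * sign j) * (a (suc j) * z)) ∑-suc) ⟩
    ∑ (λ j → (-1ℤ * sign j) * (a (suc j) * (1ℤ * (b zero * h (punchIn (suc j) ∘ suc)) + S b j)))
      ≡⟨ ∑-cong (λ j → split (sign j) (a (suc j)) (b zero) (h (punchIn (suc j) ∘ suc)) (S b j)) ⟩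
    ∑ (λ j → - b zero * (sign j * (a (suc j) * h (punchIn (suc j) ∘ suc))) + (-1ℤ * sign j) * (a (suc j) * S b j))
      ≡⟨ ∑-+ (λ j → - b zero * (sign j * (a (suc j) * h (punchIn (suc j) ∘ suc)))) (λ j → (-1ℤ * sign j) * (a (suc j) * S b j)) ⟩
    ∑ (λ j → - b zero * (sign j * (a (suc j) * h (punchIn (suc j) ∘ suc)))) + T a b
      ≡⟨ cong (_+ T a b) (trans (∑-*ˡ (- b zero) (λ j → sign j * (a (suc j) * h (punchIn (suc j) ∘ suc)))) (sym (ℤ.neg-distribˡ-* (b zero) (E a)))) ⟩
    - (b zero * E a) + T a b ∎))
  T-swap : ∀ m → n ≡ m → T a b ≡ - T b a
  -- With two columns in total, one of the two rows must take column zero.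
  T-swap zero refl = trans (vanish a b) (cong -_ (sym (vanish b a)))
    where
    vanish : ∀ a b → T a b ≡ 0ℤ
    vanish a b = ∑-zero λ j → trans (cong (λ z → (-1ℤ * sign j) * (a (suc j) * z)) ∑-nil) (*-zero (-1ℤ * sign j) (a (suc j)))
      where
      *-zero : ∀ x y → x * (y * 0ℤ) ≡ 0ℤ
      *-zero = solve-∀
  T-swap (suc m) refl = begin
    T a b
      ≡⟨ T≡ a b ⟩
    det₂ (tail a) (tail b) h′
      ≡⟨ det₂-swap (tail a) (tail b) h′ (λ e≗e′ → h-cong λ { zero → refl ; (suc i) → cong suc (e≗e′ i) }) ⟩
    - det₂ (tail b) (tail a) h′
      ≡⟨ cong -_ (T≡ b a) ⟨
    - T b a ∎
    where
    lift : (Fin m → Fin (suc (suc m))) → Fin (suc m) → Fin (suc (suc (suc m)))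
    lift e zero    = zero
    lift e (suc i) = suc (e i)
    h′ : (Fin m → Fin (suc (suc m))) → ℤ
    h′ e = h (lift e)
    S′ : Vector ℤ (suc (suc n)) → Fin (suc n) → ℤ
    S′ b j = ∑ λ k → sign k * (b (suc (punchIn j k)) * h′ (punchIn j ∘ punchIn k))
    cancel : ∀ s x z → (-1ℤ * s) * (x * (-1ℤ * z)) ≡ s * (x * z)
    cancel = solve-∀
    S≡ : ∀ b j → S b j ≡ -1ℤ * S′ b j
    S≡ b j = trans
      (∑-cong λ k → trans (ℤ.*-assoc -1ℤ (sign k) (b (suc (punchIn j k)) * h (punchIn (suc j) ∘ punchIn (suc k))))
        (cong (λ z → -1ℤ * (sign k * (b (suc (punchIn j k)) * z)))
          (h-cong {punchIn (suc j) ∘ punchIn (suc k)} {lift (punchIn j ∘ punchIn k)} λ { zero → refl ; (suc i) → refl })))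
      (∑-*ˡ -1ℤ (λ k → sign k * (b (suc (punchIn j k)) * h′ (punchIn j ∘ punchIn k))))
    T≡ : ∀ a b → T a b ≡ det₂ (tail a) (tail b) h′
    T≡ a b = ∑-cong λ j → trans (cong (λ z → (-1ℤ * sign j) * (a (suc j) * z)) (S≡ b j)) (cancel (sign j) (a (suc j)) (S′ b j))

det-expand₂ : ∀ {n} (a b : Vector ℤ (suc (suc n))) (X : Rows n (suc (suc n))) →
  Det (a ∷ b ∷ X) ≡ det₂ a b (λ e → Det λ i k → X i (e k))
det-expand₂ a b X = trans (det-expand (a ∷ b ∷ X))
  (∑-cong λ j → cong (λ z → sign j * (a j * z)) (det-expand (minor j (b ∷ X))))

det-swap : ∀ {n} (a b : Vector ℤ (suc (suc n))) (X : Rows n (suc (suc n))) →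
  Det (a ∷ b ∷ X) ≡ - Det (b ∷ a ∷ X)
det-swap a b X = begin
  Det (a ∷ b ∷ X)
    ≡⟨ det-expand₂ a b X ⟩
  det₂ a b h
    ≡⟨ det₂-swap a b h (λ e≗e′ → det-cong λ i k → cong (X i) (e≗e′ k)) ⟩
  - det₂ b a h
    ≡⟨ cong -_ (det-expand₂ b a X) ⟨
  - Det (b ∷ a ∷ X) ∎
  where
  h = λ e → Det λ i k → X i (e k)

det-linear : ∀ {n} y (a b : Vector ℤ (suc n)) (X : Rows n (suc n)) →
  Det ((λ j → a j + y * b j) ∷ X) ≡ Det (a ∷ X) + y * Det (b ∷ X)
det-linear y a b X = begin
  Det ((λ j → a j + y * b j) ∷ X)
    ≡⟨ det-expand ((λ j → a j + y * b j) ∷ X) ⟩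
  ∑ (λ j → sign j * ((a j + y * b j) * Det (minor j X)))
    ≡⟨ ∑-cong (λ j → distrib (sign j) (a j) y (b j) (Det (minor j X))) ⟩
  ∑ (λ j → sign j * (a j * Det (minor j X)) + y * (sign j * (b j * Det (minor j X))))
    ≡⟨ ∑-linear y (λ j → sign j * (a j * Det (minor j X))) (λ j → sign j * (b j * Det (minor j X))) ⟩
  ∑ (λ j → sign j * (a j * Det (minor j X))) + y * ∑ (λ j → sign j * (b j * Det (minor j X)))
    ≡⟨ cong₂ (λ u v → u + y * v) (det-expand (a ∷ X)) (det-expand (b ∷ X)) ⟨
  Det (a ∷ X) + y * Det (b ∷ X) ∎
  where
  distrib : ∀ s a y b d → s * ((a + y * b) * d) ≡ s * (a * d) + y * (s * (b * d))
  distrib = solve-∀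

det-tail : ∀ {n} (x : Vector ℤ (suc n)) {X Y : Rows n (suc n)} {c} →
  (∀ j → Det (minor j X) ≡ c * Det (minor j Y)) → Det (x ∷ X) ≡ c * Det (x ∷ Y)
det-tail x {X} {Y} {c} minors = begin
  Det (x ∷ X)
    ≡⟨ det-expand (x ∷ X) ⟩
  ∑ (λ j → sign j * (x j * Det (minor j X)))
    ≡⟨ ∑-cong (λ j → trans (cong (λ d → sign j * (x j * d)) (minors j)) (pull (sign j) (x j) c (Det (minor j Y)))) ⟩
  ∑ (λ j → c * (sign j * (x j * Det (minor j Y))))
    ≡⟨ ∑-*ˡ c (λ j → sign j * (x j * Det (minor j Y))) ⟩
  c * ∑ (λ j → sign j * (x j * Det (minor j Y)))
    ≡⟨ cong (_*_ c) (det-expand (x ∷ Y)) ⟨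
  c * Det (x ∷ Y) ∎
  where
  pull : ∀ s x c d → s * (x * (c * d)) ≡ c * (s * (x * d))
  pull = solve-∀

-*-swap : ∀ s d → s * - d ≡ (-1ℤ * s) * d
-*-swap = solve-∀

-- Induction on the position: under the fixed first row, the induction hypothesis in the minors
-- brings `b` to the second row, and one swap with the first row adds the factor -1.
det-insert : ∀ {n} (i : Fin (suc n)) b (X : Rows n (suc n)) → Det (insert i b X) ≡ sign i * Det (b ∷ X)
det-insert         zero    b X = sym (ℤ.*-identityˡ (Det (b ∷ X)))
det-insert {suc n} (suc i) b X = begin
  Det (head X ∷ insert i b (tail X))
    ≡⟨ det-tail (head X) {insert i b (tail X)} {b ∷ tail X} {sign i} (λ j → begin
         Det (minor j (insert i b (tail X)))
           ≡⟨ det-cong (λ r k → cong (λ f → f k) (map-insert (_∘ punchIn j) i r)) ⟩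
         Det (insert i (b ∘ punchIn j) (minor j (tail X)))
           ≡⟨ det-insert i (b ∘ punchIn j) (minor j (tail X)) ⟩
         sign i * Det ((b ∘ punchIn j) ∷ minor j (tail X))
           ≡⟨ cong (_*_ (sign i)) (det-cong λ { zero k → refl ; (suc r) k → refl }) ⟩
         sign i * Det (minor j (b ∷ tail X)) ∎) ⟩
  sign i * Det (head X ∷ b ∷ tail X)
    ≡⟨ cong (_*_ (sign i)) (det-swap (head X) b (tail X)) ⟩
  sign i * - Det (b ∷ head X ∷ tail X)
    ≡⟨ -*-swap (sign i) (Det (b ∷ head X ∷ tail X)) ⟩
  (-1ℤ * sign i) * Det (b ∷ head X ∷ tail X)
    ≡⟨ cong (_*_ (-1ℤ * sign i)) (det-cong λ { zero j → refl ; (suc zero) j → refl ; (suc (suc r)) j → refl }) ⟩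
  (-1ℤ * sign i) * Det (b ∷ X) ∎

-- A multilinear alternating form in the rows of a matrix; linearity in the other rows follows
-- by moving them to the front.
record Alternating {k m} (ω : Rows (suc k) m → ℤ) : Set where
  field
    respects : ∀ {X Y} → X ≐ Y → ω X ≡ ω Y
    linear   : ∀ y a b X → ω ((λ j → a j + y * b j) ∷ X) ≡ ω (a ∷ X) + y * ω (b ∷ X)
    move     : ∀ i b X → ω (insert i b X) ≡ sign i * ω (b ∷ X)

  linear-zero : ∀ X → ω ((λ _ → 0ℤ) ∷ X) ≡ 0ℤ
  linear-zero X = trans
    (respects {z ∷ X} {(λ j → z j + -1ℤ * z j) ∷ X} λ { zero j → refl ; (suc i) j → refl })
    (trans (linear -1ℤ z z X) (cancel (ω (z ∷ X))))
    where
    z = λ _ → 0ℤ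
    cancel : ∀ x → x + -1ℤ * x ≡ 0ℤ
    cancel = solve-∀

  linear-∑ : ∀ {n} (c : Fin n → ℤ) (a : Rows n m) X →
    ω ((λ j → ∑ λ i → c i * a i j) ∷ X) ≡ ∑ λ i → c i * ω (a i ∷ X)
  linear-∑ {zero} c a X = trans (respects λ { zero j → ∑-nil ; (suc i) j → refl })
    (trans (linear-zero X) (sym ∑-nil))
  linear-∑ {suc n} c a X = begin
    ω ((λ j → ∑ λ i → c i * a i j) ∷ X)
      ≡⟨ respects (λ { zero j → trans ∑-suc (ℤ.+-comm (c zero * a zero j) (∑ λ i → c (suc i) * a (suc i) j)) ; (suc i) j → refl }) ⟩
    ω ((λ j → ∑ (λ i → c (suc i) * a (suc i) j) + c zero * a zero j) ∷ X)
      ≡⟨ linear (c zero) (λ j → ∑ (λ i → c (suc i) * a (suc i) j)) (a zero) X ⟩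
    ω ((λ j → ∑ (λ i → c (suc i) * a (suc i) j)) ∷ X) + c zero * ω (a zero ∷ X)
      ≡⟨ cong (_+ c zero * ω (a zero ∷ X)) (linear-∑ (c ∘ suc) (a ∘ suc) X) ⟩
    ∑ (λ i → c (suc i) * ω (a (suc i) ∷ X)) + c zero * ω (a zero ∷ X)
      ≡⟨ ℤ.+-comm (∑ λ i → c (suc i) * ω (a (suc i) ∷ X)) (c zero * ω (a zero ∷ X)) ⟩
    c zero * ω (a zero ∷ X) + ∑ (λ i → c (suc i) * ω (a (suc i) ∷ X))
      ≡⟨ ∑-suc ⟨
    ∑ (λ i → c i * ω (a i ∷ X)) ∎

∷-cong : ∀ {k m} {x : Vector ℤ m} {X Y : Rows k m} → X ≐ Y → (x ∷ X) ≐ (x ∷ Y)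
∷-cong X≐Y zero    j = refl
∷-cong X≐Y (suc i) j = X≐Y i j

module _ {k m} {ω : Rows (suc (suc k)) m → ℤ} (alt : Alternating ω) where
  open Alternating alt

  swap : ∀ a b X → ω (a ∷ b ∷ X) ≡ - ω (b ∷ a ∷ X)
  swap a b X = trans (move (suc zero) b (a ∷ X)) (ℤ.-1*i≡-i (ω (b ∷ a ∷ X)))

  -- Lets inductions on the number of rows peel off the first one. Linearity in the next row follows
  -- by swapping the fixed row out of the way and back.
  fix-head : ∀ x → Alternating (λ X → ω (x ∷ X))
  fix-head x = record
    { respects = λ X≐Y → respects (∷-cong X≐Y)
    ; linear = λ y a b X → begin
        ω (x ∷ (λ j → a j + y * b j) ∷ X)
          ≡⟨ swap x (λ j → a j + y * b j) X ⟩
        - ω ((λ j → a j + y * b j) ∷ x ∷ X)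
          ≡⟨ cong -_ (linear y a b (x ∷ X)) ⟩
        - (ω (a ∷ x ∷ X) + y * ω (b ∷ x ∷ X))
          ≡⟨ distrib (ω (a ∷ x ∷ X)) y (ω (b ∷ x ∷ X)) ⟩
        - ω (a ∷ x ∷ X) + y * - ω (b ∷ x ∷ X)
          ≡⟨ cong₂ (λ u v → u + y * v) (swap x a X) (swap x b X) ⟨
        ω (x ∷ a ∷ X) + y * ω (x ∷ b ∷ X) ∎
    ; move = λ i b X → begin
        ω (x ∷ insert i b X)
          ≡⟨ move (suc i) b (x ∷ X) ⟩
        (-1ℤ * sign i) * ω (b ∷ x ∷ X)
          ≡⟨ -*-swap (sign i) (ω (b ∷ x ∷ X)) ⟨
        sign i * - ω (b ∷ x ∷ X)
          ≡⟨ cong (_*_ (sign i)) (swap x b X) ⟨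
        sign i * ω (x ∷ b ∷ X) ∎
    }
    where
    distrib : ∀ u y v → - (u + y * v) ≡ - u + y * - v
    distrib = solve-∀

-- If the equal rows are adjacent, a swap gives x = -x, hence x = 0 in ℤ. Otherwise one swap puts
-- `X zero` first, and the equal pair lies in the form with that row fixed.
repeated-row : ∀ {k m} {ω : Rows (suc (suc k)) m → ℤ} → Alternating ω → ∀ j X → ω (X j ∷ X) ≡ 0ℤ
repeated-row {ω = ω} alt zero X = self-negative (ω (X zero ∷ X)) (begin
  ω (X zero ∷ X)
    ≡⟨ respects (∷-cong (∷-η X)) ⟩
  ω (X zero ∷ X zero ∷ tail X)
    ≡⟨ swap alt (X zero) (X zero) (tail X) ⟩
  - ω (X zero ∷ X zero ∷ tail X)
    ≡⟨ cong -_ (respects (∷-cong (∷-η X))) ⟨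
  - ω (X zero ∷ X) ∎)
  where
  open Alternating alt
  ∷-η : ∀ {k m} (X : Rows (suc k) m) → X ≐ (X zero ∷ tail X)
  ∷-η X zero    j = refl
  ∷-η X (suc i) j = refl
  self-negative : ∀ x → x ≡ - x → x ≡ 0ℤ
  self-negative (+ zero)  _ = refl
  self-negative (+ suc n) ()
  self-negative -[1+ n ] ()
repeated-row {suc k} {ω = ω} alt (suc j) X = begin
  ω (X (suc j) ∷ X)
    ≡⟨ respects (λ { zero i → refl ; (suc zero) i → refl ; (suc (suc r)) i → refl }) ⟩
  ω (X (suc j) ∷ X zero ∷ tail X)
    ≡⟨ swap alt (X (suc j)) (X zero) (tail X) ⟩
  - ω (X zero ∷ X (suc j) ∷ tail X)
    ≡⟨ cong -_ (repeated-row (fix-head alt (X zero)) j (tail X)) ⟩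
  0ℤ ∎
  where open Alternating alt
repeated-row {zero} alt (suc ()) X

det-alternating : ∀ {n} → Alternating {n} {suc n} Det
det-alternating = record { respects = det-cong ; linear = det-linear ; move = det-insert }

det-move : ∀ {n} (i : Fin (suc n)) (A : Matrix (suc n)) → Det A ≡ sign i * Det (A i ∷ A ∘ punchIn i)
det-move i A = trans (det-cong (λ r j → cong (λ f → f j) (sym (insert-remove i A r)))) (det-insert i (A i) (A ∘ punchIn i))

det-repeated : ∀ {n} (A : Matrix n) {i j} → i ≢ j → (∀ k → A i k ≡ A j k) → Det A ≡ 0ℤ
det-repeated {suc zero} A {zero} {zero} i≢j _ with () ← i≢j refl
det-repeated {suc (suc n)} A {i} {j} i≢j Aᵢ≡Aⱼ = begin
  Det A
    ≡⟨ det-move i A ⟩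
  sign i * Det (A i ∷ A ∘ punchIn i)
    ≡⟨ cong (_*_ (sign i)) (det-cong λ { zero k → trans (Aᵢ≡Aⱼ k) (cong (λ r → A r k) (sym (punchIn-punchOut i≢j))) ; (suc r) k → refl }) ⟩
  sign i * Det (A (punchIn i (punchOut i≢j)) ∷ A ∘ punchIn i)
    ≡⟨ cong (_*_ (sign i)) (repeated-row det-alternating (punchOut i≢j) (A ∘ punchIn i)) ⟩
  sign i * 0ℤ
    ≡⟨ ℤ.*-zeroʳ (sign i) ⟩
  0ℤ ∎

-- Expand along the first row and then, using the result for smaller matrices, each minor along its
-- first column. Transposition interchanges the two summation indices and, by the result two sizes
-- down, preserves each term; hence the two small base cases.
det-transpose : ∀ {n} (A : Matrix n) → Det (λ i j → A j i) ≡ Det A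
det-transpose {zero}        A = det-cong λ ()
det-transpose {suc zero}    A = det-cong λ { zero zero → refl }
det-transpose {suc (suc n)} A = begin
  Det (λ i j → A j i)
    ≡⟨ expand-row-column det-transpose (λ i j → A j i) ⟩
  1ℤ * (A zero zero * Det (minor zero (tail λ i j → A j i))) + ∑ (λ i → ∑ (term (λ i j → A j i) i))
    ≡⟨ cong₂ (λ u v → 1ℤ * (A zero zero * u) + v) (det-transpose (minor zero (tail A)))
         (trans (∑-comm (term λ i j → A j i)) (∑-cong λ j → ∑-cong λ i → transpose-term i j)) ⟩
  1ℤ * (A zero zero * Det (minor zero (tail A))) + ∑ (λ j → ∑ (term A j))
    ≡⟨ expand-row-column det-transpose A ⟨
  Det A ∎
  where
  inner : Matrix (suc (suc n)) → Fin (suc n) → Fin (suc n) → Matrix n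
  inner A j i c r = A (suc (punchIn i r)) (suc (punchIn j c))
  term : Matrix (suc (suc n)) → Fin (suc n) → Fin (suc n) → ℤ
  term A j i = (-1ℤ * sign j) * (A zero (suc j) * (sign i * (A (suc i) zero * Det (inner A j i))))
  expand-row-column : (∀ B → Det {suc n} (λ i j → B j i) ≡ Det B) → ∀ A → Det A ≡ 1ℤ * (A zero zero * Det (minor zero (tail A))) + ∑ (λ j → ∑ (term A j))
  expand-row-column transpose A = trans (det-expand A) (trans ∑-suc
    (cong (_+_ (1ℤ * (A zero zero * Det (minor zero (tail A))))) (∑-cong λ j → begin
      (-1ℤ * sign j) * (A zero (suc j) * Det (minor (suc j) (tail A)))
        ≡⟨ cong (λ d → (-1ℤ * sign j) * (A zero (suc j) * d)) (trans (sym (transpose (minor (suc j) (tail A))))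
             (det-expand λ c r → minor (suc j) (tail A) r c)) ⟩
      (-1ℤ * sign j) * (A zero (suc j) * ∑ (λ i → sign i * (A (suc i) zero * Det (inner A j i))))
        ≡⟨ trans (∑-*ˡ (-1ℤ * sign j) λ i → A zero (suc j) * (sign i * (A (suc i) zero * Det (inner A j i))))
             (cong (_*_ (-1ℤ * sign j)) (∑-*ˡ (A zero (suc j)) λ i → sign i * (A (suc i) zero * Det (inner A j i)))) ⟨
      ∑ (term A j) ∎)))
  transpose-term : ∀ i j → term (λ i j → A j i) i j ≡ term A j i
  transpose-term i j = trans
    (cong (λ d → (-1ℤ * sign i) * (A (suc i) zero * (sign j * (A zero (suc j) * d)))) (det-transpose (inner A j i)))
    (rearrange (sign i) (A (suc i) zero) (sign j) (A zero (suc j)) (Det (inner A j i)))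
    where
    rearrange : ∀ s x t y d → (-1ℤ * s) * (x * (t * (y * d))) ≡ (-1ℤ * t) * (y * (s * (x * d)))
    rearrange = solve-∀

-- Sums over all k-tuples of indices

∑ᵗ : ∀ {n} k → ((Fin k → Fin n) → ℤ) → ℤ
∑ᵗ zero    F = F []
∑ᵗ (suc k) F = ∑ λ a → ∑ᵗ k λ I → F (a ∷ I)

module _ {n : ℕ} where

  ∑ᵗ-cong : ∀ k {F G : (Fin k → Fin n) → ℤ} → (∀ I → F I ≡ G I) → ∑ᵗ k F ≡ ∑ᵗ k G
  ∑ᵗ-cong zero    F≡G = F≡G []
  ∑ᵗ-cong (suc k) F≡G = ∑-cong λ a → ∑ᵗ-cong k λ I → F≡G (a ∷ I)

  ∑ᵗ-insert : ∀ k (j : Fin (suc k)) (F : (Fin (suc k) → Fin n) → ℤ) →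
    ∑ᵗ (suc k) F ≡ ∑ λ a → ∑ᵗ k λ I → F (insert j a I)
  ∑ᵗ-insert k       zero    F = refl
  ∑ᵗ-insert (suc k) (suc j) F = trans
    (∑-cong λ a → ∑ᵗ-insert k j λ J → F (a ∷ J))
    (∑-comm λ a b → ∑ᵗ k λ I → F (a ∷ insert j b I))

  ∑ᵗ-*ˡ : ∀ k x (F : (Fin k → Fin n) → ℤ) → ∑ᵗ k (λ I → x * F I) ≡ x * ∑ᵗ k F
  ∑ᵗ-*ˡ zero    x F = refl
  ∑ᵗ-*ˡ (suc k) x F = trans (∑-cong λ a → ∑ᵗ-*ˡ k x λ I → F (a ∷ I)) (∑-*ˡ x λ a → ∑ᵗ k λ I → F (a ∷ I))

  ∑ᵗ-∑ : ∀ k {m} (f : Fin m → (Fin k → Fin n) → ℤ) → ∑ᵗ k (λ I → ∑ λ c → f c I) ≡ ∑ λ c → ∑ᵗ k (f c)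
  ∑ᵗ-∑ zero    f = refl
  ∑ᵗ-∑ (suc k) f = trans (∑-cong λ a → ∑ᵗ-∑ k λ c I → f c (a ∷ I)) (∑-comm λ a c → ∑ᵗ k λ I → f c (a ∷ I))

  ∑ᵗ-+ : ∀ k (F G : (Fin k → Fin n) → ℤ) → ∑ᵗ k (λ I → F I + G I) ≡ ∑ᵗ k F + ∑ᵗ k G
  ∑ᵗ-+ zero    F G = refl
  ∑ᵗ-+ (suc k) F G = trans (∑-cong λ a → ∑ᵗ-+ k (λ I → F (a ∷ I)) (λ I → G (a ∷ I)))
    (∑-+ (λ a → ∑ᵗ k λ I → F (a ∷ I)) (λ a → ∑ᵗ k λ I → G (a ∷ I)))

∑-const : ∀ n x → ∑ {n} (λ _ → x) ≡ + n * x
∑-const zero    x = trans ∑-nil (sym (ℤ.*-zeroˡ x))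
∑-const (suc n) x = trans ∑-suc (trans (cong (_+_ x) (∑-const n x)) (sym (ℤ.suc-* (+ n) x)))

-- Matrix products and the Cauchy-Binet formula

infixl 7 _⊛_
_⊛_ : ∀ {k n m} → Rows k n → Rows n m → Rows k m
(A ⊛ B) i j = ∑ λ a → A i a * B a j

module _ {k n m} {ω : Rows (suc k) m → ℤ} (alt : Alternating ω) (A : Rows (suc k) n) (B : Rows n m) where
  open Alternating alt

  private
    Δ : Fin (suc k) → (Fin (suc k) → Fin n) → ℤ
    Δ c J = Det λ r d → A (suc r) (J (punchIn c d))
    e : Fin n → (Fin k → Fin n) → ℤ
    e a K = A zero a * (Det (λ r d → A (suc r) (K d)) * ω (B a ∷ B ∘ K))
    term : Fin (suc k) → (Fin (suc k) → Fin n) → ℤ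
    term c J = (sign c * (A zero (J c) * Δ c J)) * ω (B ∘ J)

    term-insert : ∀ c a K → term c (insert c a K) ≡ e a K
    term-insert c a K = begin
      (sign c * (A zero (insert c a K c) * Δ c (insert c a K))) * ω (B ∘ insert c a K)
        ≡⟨ cong₂ _*_ (cong₂ (λ u v → sign c * (A zero u * v)) (insert-lookup c) (det-cong λ r d → cong (A (suc r)) (insert-punchIn c d)))
             (trans (respects λ i j → cong (λ f → f j) (map-insert B c i)) (move c (B a) (B ∘ K))) ⟩
      (sign c * (A zero a * Det (λ r d → A (suc r) (K d)))) * (sign c * ω (B a ∷ B ∘ K))
        ≡⟨ regroup (sign c) (A zero a) (Det (λ r d → A (suc r) (K d))) (ω (B a ∷ B ∘ K)) ⟩
      (sign c * sign c) * e a K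
        ≡⟨ cong (_* e a K) (sign² c) ⟩
      1ℤ * e a K
        ≡⟨ ℤ.*-identityˡ (e a K) ⟩
      e a K ∎
      where
      regroup : ∀ s x d w → (s * (x * d)) * (s * w) ≡ (s * s) * (x * (d * w))
      regroup = solve-∀

  -- Expand the determinant along the first row of `A`. Choosing column `c` costs `sign c`, and
  -- moving row `J c` of `B` to the front of `ω` costs the same sign again, so all `suc k` choices
  -- contribute equally. Linearity then collects the front rows into the first row of `A ⊛ B`.
  cauchy-binet-step :
    ∑ᵗ (suc k) (λ J → Det (λ r c → A r (J c)) * ω (B ∘ J)) ≡
    + suc k * ∑ᵗ k (λ K → Det (λ r c → A (suc r) (K c)) * ω ((A ⊛ B) zero ∷ B ∘ K))
  cauchy-binet-step = begin
    ∑ᵗ (suc k) (λ J → Det (λ r c → A r (J c)) * ω (B ∘ J))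
      ≡⟨ ∑ᵗ-cong (suc k) (λ J → trans (cong (_* ω (B ∘ J)) (det-expand λ r c → A r (J c)))
           (sym (∑-*ʳ (ω (B ∘ J)) λ c → sign c * (A zero (J c) * Δ c J)))) ⟩
    ∑ᵗ (suc k) (λ J → ∑ λ c → term c J)
      ≡⟨ ∑ᵗ-∑ (suc k) term ⟩
    ∑ (λ c → ∑ᵗ (suc k) (term c))
      ≡⟨ ∑-cong (λ c → trans (∑ᵗ-insert k c (term c)) (∑-cong λ a → ∑ᵗ-cong k (term-insert c a))) ⟩
    ∑ {suc k} (λ c → ∑ λ a → ∑ᵗ k (e a))
      ≡⟨ ∑-const (suc k) (∑ λ a → ∑ᵗ k (e a)) ⟩
    + suc k * ∑ (λ a → ∑ᵗ k (e a))
      ≡⟨ cong (_*_ (+ suc k)) (∑ᵗ-∑ k e) ⟨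
    + suc k * ∑ᵗ k (λ K → ∑ λ a → e a K)
      ≡⟨ cong (_*_ (+ suc k)) (∑ᵗ-cong k λ K → begin
           ∑ (λ a → e a K)
             ≡⟨ ∑-cong (λ a → pull (A zero a) (Det λ r c → A (suc r) (K c)) (ω (B a ∷ B ∘ K))) ⟩
           ∑ (λ a → Det (λ r c → A (suc r) (K c)) * (A zero a * ω (B a ∷ B ∘ K)))
             ≡⟨ ∑-*ˡ (Det λ r c → A (suc r) (K c)) (λ a → A zero a * ω (B a ∷ B ∘ K)) ⟩
           Det (λ r c → A (suc r) (K c)) * ∑ (λ a → A zero a * ω (B a ∷ B ∘ K))
             ≡⟨ cong (_*_ (Det λ r c → A (suc r) (K c))) (linear-∑ (A zero) B (B ∘ K)) ⟨
           Det (λ r c → A (suc r) (K c)) * ω ((A ⊛ B) zero ∷ B ∘ K) ∎) ⟩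
    + suc k * ∑ᵗ k (λ K → Det (λ r c → A (suc r) (K c)) * ω ((A ⊛ B) zero ∷ B ∘ K)) ∎
    where
    pull : ∀ x d w → x * (d * w) ≡ d * (x * w)
    pull = solve-∀

-- Summing over all tuples instead of increasing ones explains the factorial. A general alternating
-- `ω` in place of `Det` is what the induction needs: after one step, the first row of the product
-- is fixed by `fix-head` and the form acts on the remaining rows.
cauchy-binet : ∀ {k n m} {ω : Rows (suc k) m → ℤ} → Alternating ω → (A : Rows (suc k) n) (B : Rows n m) →
  ∑ᵗ (suc k) (λ J → Det (λ r c → A r (J c)) * ω (B ∘ J)) ≡ + (suc k !) * ω (A ⊛ B)
cauchy-binet {zero} {ω = ω} alt A B = begin
  ∑ᵗ 1 (λ J → Det (λ r c → A r (J c)) * ω (B ∘ J))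
    ≡⟨ cauchy-binet-step alt A B ⟩
  1ℤ * (Det (λ r c → A (suc r) ([] c)) * ω ((A ⊛ B) zero ∷ B ∘ []))
    ≡⟨ cong (_*_ 1ℤ) (cong₂ _*_ (det-nil λ r c → A (suc r) ([] c)) (respects λ { zero j → refl })) ⟩
  1ℤ * (1ℤ * ω (A ⊛ B))
    ≡⟨ cong (_*_ 1ℤ) (ℤ.*-identityˡ (ω (A ⊛ B))) ⟩
  1ℤ * ω (A ⊛ B) ∎
  where open Alternating alt
cauchy-binet {suc k} {ω = ω} alt A B = begin
  ∑ᵗ (suc (suc k)) (λ J → Det (λ r c → A r (J c)) * ω (B ∘ J))
    ≡⟨ cauchy-binet-step alt A B ⟩
  + suc (suc k) * ∑ᵗ (suc k) (λ K → Det (λ r c → A (suc r) (K c)) * ω ((A ⊛ B) zero ∷ B ∘ K))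
    ≡⟨ cong (_*_ (+ suc (suc k))) (cauchy-binet (fix-head alt ((A ⊛ B) zero)) (A ∘ suc) B) ⟩
  + suc (suc k) * (+ (suc k !) * ω ((A ⊛ B) zero ∷ (A ∘ suc) ⊛ B))
    ≡⟨ ℤ.*-assoc (+ suc (suc k)) (+ (suc k !)) (ω ((A ⊛ B) zero ∷ (A ∘ suc) ⊛ B)) ⟨
  + suc (suc k) * + (suc k !) * ω ((A ⊛ B) zero ∷ (A ∘ suc) ⊛ B)
    ≡⟨ cong₂ _*_ (sym (ℤ.pos-* (suc (suc k)) (suc k !))) (respects λ { zero j → refl ; (suc i) j → refl }) ⟩
  + (suc (suc k) !) * ω (A ⊛ B) ∎
  where open Alternating alt

-- The sum of the principal minors over all k-tuples, each k-subset counted k! times.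
principal : ∀ {n} → Matrix n → ℕ → ℤ
principal N k = ∑ᵗ k λ I → Det λ r c → N (I r) (I c)

-- By symmetry of `M`, transposing one of the two equal factors turns its rows `I` and columns `J`
-- into rows `J` and columns `I`; Cauchy-Binet over `J` then gives the principal minor of M² at `I`.
sum-of-squared-minors : ∀ {n} (M : Matrix n) → (∀ i j → M i j ≡ M j i) → ∀ k →
  ∑ᵗ (suc k) (λ I → ∑ᵗ (suc k) λ J → Det (λ r c → M (I r) (J c)) * Det (λ r c → M (I r) (J c))) ≡
  + (suc k !) * principal (M ⊛ M) (suc k)
sum-of-squared-minors M M-sym k = begin
  ∑ᵗ (suc k) (λ I → ∑ᵗ (suc k) λ J → Det (λ r c → M (I r) (J c)) * Det (λ r c → M (I r) (J c)))
    ≡⟨ ∑ᵗ-cong (suc k) (λ I → ∑ᵗ-cong (suc k) λ J → cong (_*_ (Det λ r c → M (I r) (J c)))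
         (trans (sym (det-transpose λ r c → M (I r) (J c))) (det-cong λ r c → M-sym (I c) (J r)))) ⟩
  ∑ᵗ (suc k) (λ I → ∑ᵗ (suc k) λ J → Det (λ r c → M (I r) (J c)) * Det (λ r c → M (J r) (I c)))
    ≡⟨ ∑ᵗ-cong (suc k) (λ I → cauchy-binet det-alternating (M ∘ I) (λ a c → M a (I c))) ⟩
  ∑ᵗ (suc k) (λ I → + (suc k !) * Det (λ r c → (M ⊛ M) (I r) (I c)))
    ≡⟨ ∑ᵗ-*ˡ (suc k) (+ (suc k !)) (λ I → Det λ r c → (M ⊛ M) (I r) (I c)) ⟩
  + (suc k !) * principal (M ⊛ M) (suc k) ∎

-- Traces and the recursion for sums of principal minors

tr : ∀ {n} → Matrix n → ℤ
tr A = ∑ λ i → A i i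

tr-cong : ∀ {n} {A B : Matrix n} → A ≐ B → tr A ≡ tr B
tr-cong A≐B = ∑-cong λ i → A≐B i i

⊛-assoc : ∀ {k l m n} (A : Rows k l) (B : Rows l m) (C : Rows m n) → (A ⊛ B) ⊛ C ≐ A ⊛ (B ⊛ C)
⊛-assoc A B C i j = begin
  ∑ (λ b → ∑ (λ a → A i a * B a b) * C b j)
    ≡⟨ ∑-cong (λ b → trans (sym (∑-*ʳ (C b j) λ a → A i a * B a b)) (∑-cong λ a → ℤ.*-assoc (A i a) (B a b) (C b j))) ⟩
  ∑ (λ b → ∑ λ a → A i a * (B a b * C b j))
    ≡⟨ ∑-comm (λ b a → A i a * (B a b * C b j)) ⟩
  ∑ (λ a → ∑ λ b → A i a * (B a b * C b j))
    ≡⟨ ∑-cong (λ a → ∑-*ˡ (A i a) λ b → B a b * C b j) ⟩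
  ∑ (λ a → A i a * ∑ λ b → B a b * C b j) ∎

-- The power M^(k+1).
power⁺ : ∀ {n} → Matrix n → ℕ → Matrix n
power⁺ M zero    = M
power⁺ M (suc k) = power⁺ M k ⊛ M

module _ {n} (N : Matrix n) where

  -- Up to sign and the factor k!, this is `N` times a matrix of the Faddeev-LeVerrier recursion;
  -- its trace is `principal N (suc k)`.
  bordered : ∀ k → Matrix n
  bordered k u v = ∑ᵗ k λ I → Det λ r c → N ((u ∷ I) r) ((v ∷ I) c)

  bordered-zero : ∀ u v → bordered 0 u v ≡ N u v
  bordered-zero u v = begin
    Det A
      ≡⟨ trans (det-expand A) ∑-suc ⟩
    1ℤ * (N u v * Det (minor zero (tail A))) + ∑ (λ j → sign (suc j) * (A zero (suc j) * Det (minor (suc j) (tail A))))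
      ≡⟨ cong₂ (λ d s → 1ℤ * (N u v * d) + s) (det-nil (minor zero (tail A))) ∑-nil ⟩
    1ℤ * (N u v * 1ℤ) + 0ℤ
      ≡⟨ unit (N u v) ⟩
    N u v ∎
    where
    A : Matrix 1
    A r c = N ((u ∷ []) r) ((v ∷ []) c)
    unit : ∀ x → 1ℤ * (x * 1ℤ) + 0ℤ ≡ x
    unit = solve-∀

  -- Expand along row `u`. Column `v` leaves a principal minor. A column a = `I j` leaves a minor
  -- whose row `a` can be moved to the front, giving a minor bordered by `a` and `v`; the position
  -- signs cancel up to one factor -1, and the `suc k` positions contribute equally.
  bordered-suc : ∀ k u v → bordered (suc k) u v ≡
    N u v * principal N (suc k) + -[1+ k ] * ∑ λ a → N u a * bordered k a v
  bordered-suc k u v = begin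
    ∑ᵗ (suc k) (λ I → Det λ r c → N ((u ∷ I) r) ((v ∷ I) c))
      ≡⟨ ∑ᵗ-cong (suc k) (λ I → trans (det-expand λ r c → N ((u ∷ I) r) ((v ∷ I) c)) ∑-suc) ⟩
    ∑ᵗ (suc k) (λ I → 1ℤ * (N u v * Det λ r c → N (I r) (I c)) + ∑ λ j → term j I)
      ≡⟨ ∑ᵗ-+ (suc k) (λ I → 1ℤ * (N u v * Det λ r c → N (I r) (I c))) (λ I → ∑ λ j → term j I) ⟩
    ∑ᵗ (suc k) (λ I → 1ℤ * (N u v * Det λ r c → N (I r) (I c))) + ∑ᵗ (suc k) (λ I → ∑ λ j → term j I)
      ≡⟨ cong₂ _+_ first rest ⟩
    N u v * principal N (suc k) + -[1+ k ] * ∑ (λ a → N u a * bordered k a v) ∎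
    where
    term : Fin (suc k) → (Fin (suc k) → Fin n) → ℤ
    term j I = (-1ℤ * sign j) * (N u (I j) * Det λ r c → N (I r) ((v ∷ I) (punchIn (suc j) c)))
    first : ∑ᵗ (suc k) (λ I → 1ℤ * (N u v * Det λ r c → N (I r) (I c))) ≡ N u v * principal N (suc k)
    first = trans
      (∑ᵗ-cong (suc k) λ I → ℤ.*-identityˡ (N u v * Det λ r c → N (I r) (I c)))
      (∑ᵗ-*ˡ (suc k) (N u v) λ I → Det λ r c → N (I r) (I c))
    e : Fin n → (Fin k → Fin n) → ℤ
    e a K = N u a * Det λ r c → N ((a ∷ K) r) ((v ∷ K) c)
    term-insert : ∀ j a K → term j (insert j a K) ≡ -1ℤ * e a K
    term-insert j a K = begin
      term j (insert j a K)
        ≡⟨ cong₂ (λ x d → (-1ℤ * sign j) * (N u x * d)) (insert-lookup j) (det-cong λ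
             { r zero    → cong (λ f → f zero) (map-insert (λ x c → N x ((v ∷ K) c)) j r)
             ; r (suc c) → trans (cong (N (insert j a K r)) (insert-punchIn j c))
                                 (cong (λ f → f (suc c)) (map-insert (λ x c → N x ((v ∷ K) c)) j r)) }) ⟩
      (-1ℤ * sign j) * (N u a * Det (insert j (λ c → N a ((v ∷ K) c)) (λ r c → N (K r) ((v ∷ K) c))))
        ≡⟨ cong (λ d → (-1ℤ * sign j) * (N u a * d)) (trans
             (det-insert j (λ c → N a ((v ∷ K) c)) (λ r c → N (K r) ((v ∷ K) c)))
             (cong (_*_ (sign j)) (det-cong λ { zero c → refl ; (suc r) c → refl }))) ⟩
      (-1ℤ * sign j) * (N u a * (sign j * Det λ r c → N ((a ∷ K) r) ((v ∷ K) c)))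
        ≡⟨ regroup (sign j) (N u a) (Det λ r c → N ((a ∷ K) r) ((v ∷ K) c)) ⟩
      (sign j * sign j) * (-1ℤ * e a K)
        ≡⟨ trans (cong (_* (-1ℤ * e a K)) (sign² j)) (ℤ.*-identityˡ (-1ℤ * e a K)) ⟩
      -1ℤ * e a K ∎
      where
      regroup : ∀ s x d → (-1ℤ * s) * (x * (s * d)) ≡ (s * s) * (-1ℤ * (x * d))
      regroup = solve-∀
    rest : ∑ᵗ (suc k) (λ I → ∑ λ j → term j I) ≡ -[1+ k ] * ∑ (λ a → N u a * bordered k a v)
    rest = begin
      ∑ᵗ (suc k) (λ I → ∑ λ j → term j I)
        ≡⟨ ∑ᵗ-∑ (suc k) term ⟩
      ∑ (λ j → ∑ᵗ (suc k) (term j))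
        ≡⟨ ∑-cong (λ j → trans (∑ᵗ-insert k j (term j)) (∑-cong λ a → ∑ᵗ-cong k (term-insert j a))) ⟩
      ∑ {suc k} (λ j → ∑ λ a → ∑ᵗ k λ K → -1ℤ * e a K)
        ≡⟨ ∑-const (suc k) (∑ λ a → ∑ᵗ k λ K → -1ℤ * e a K) ⟩
      + suc k * ∑ (λ a → ∑ᵗ k λ K → -1ℤ * e a K)
        ≡⟨ cong (_*_ (+ suc k)) (trans (∑-cong λ a → trans (∑ᵗ-*ˡ k -1ℤ (e a))
             (cong (_*_ -1ℤ) (∑ᵗ-*ˡ k (N u a) λ K → Det λ r c → N ((a ∷ K) r) ((v ∷ K) c))))
             (∑-*ˡ -1ℤ λ a → N u a * bordered k a v)) ⟩
      + suc k * (-1ℤ * ∑ (λ a → N u a * bordered k a v))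
        ≡⟨ trans (shift (+ suc k) (∑ λ a → N u a * bordered k a v)) (cong (_* ∑ (λ a → N u a * bordered k a v)) (ℤ.-1*i≡-i (+ suc k))) ⟩
      -[1+ k ] * ∑ (λ a → N u a * bordered k a v) ∎
      where
      shift : ∀ x y → x * (-1ℤ * y) ≡ (-1ℤ * x) * y
      shift = solve-∀

  -- The trace of `bordered k` times `W`. Carrying the weight along closes the recursion: each step
  -- lowers `k` and replaces `W` by `W ⊛ N`, so in the end only traces remain.
  weighted : Matrix n → ℕ → ℤ
  weighted W k = ∑ λ u → ∑ λ v → bordered k u v * W v u

  weighted-zero : ∀ W → weighted W 0 ≡ tr (W ⊛ N)
  weighted-zero W = trans
    (∑-comm λ u v → bordered 0 u v * W v u)
    (∑-cong λ v → ∑-cong λ u → trans (cong (_* W v u) (bordered-zero u v)) (ℤ.*-comm (N u v) (W v u)))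

  weighted-suc : ∀ W k → weighted W (suc k) ≡
    tr (W ⊛ N) * principal N (suc k) + -[1+ k ] * weighted (W ⊛ N) k
  weighted-suc W k = begin
    ∑ (λ u → ∑ λ v → bordered (suc k) u v * W v u)
      ≡⟨ ∑-comm (λ u v → bordered (suc k) u v * W v u) ⟩
    ∑ (λ v → ∑ λ u → bordered (suc k) u v * W v u)
      ≡⟨ ∑-cong (λ v → trans (∑-cong λ u → term u v) (trans
           (∑-linear -[1+ k ] (λ u → W v u * N u v * P) (λ u → ∑ λ a → W v u * N u a * bordered k a v))
           (cong₂ (λ x y → x + -[1+ k ] * y) (∑-*ʳ P λ u → W v u * N u v)
             (trans (∑-comm λ u a → W v u * N u a * bordered k a v) (∑-cong λ a → ∑-*ʳ (bordered k a v) λ u → W v u * N u a))))) ⟩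
    ∑ (λ v → (W ⊛ N) v v * P + -[1+ k ] * ∑ λ a → (W ⊛ N) v a * bordered k a v)
      ≡⟨ ∑-linear -[1+ k ] (λ v → (W ⊛ N) v v * P) (λ v → ∑ λ a → (W ⊛ N) v a * bordered k a v) ⟩
    ∑ (λ v → (W ⊛ N) v v * P) + -[1+ k ] * ∑ (λ v → ∑ λ a → (W ⊛ N) v a * bordered k a v)
      ≡⟨ cong₂ (λ x y → x + -[1+ k ] * y) (∑-*ʳ P λ v → (W ⊛ N) v v)
           (trans (∑-comm λ v a → (W ⊛ N) v a * bordered k a v)
             (∑-cong λ a → ∑-cong λ v → ℤ.*-comm ((W ⊛ N) v a) (bordered k a v))) ⟩
    tr (W ⊛ N) * P + -[1+ k ] * weighted (W ⊛ N) k ∎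
    where
    P = principal N (suc k)
    term : ∀ u v → bordered (suc k) u v * W v u ≡
      W v u * N u v * P + -[1+ k ] * ∑ λ a → W v u * N u a * bordered k a v
    term u v = begin
      bordered (suc k) u v * W v u
        ≡⟨ cong (_* W v u) (bordered-suc k u v) ⟩
      (N u v * P + -[1+ k ] * ∑ (λ a → N u a * bordered k a v)) * W v u
        ≡⟨ regroup (N u v) P -[1+ k ] (∑ λ a → N u a * bordered k a v) (W v u) ⟩
      W v u * N u v * P + -[1+ k ] * (W v u * ∑ (λ a → N u a * bordered k a v))
        ≡⟨ cong (λ z → W v u * N u v * P + -[1+ k ] * z) (trans
             (∑-cong λ a → ℤ.*-assoc (W v u) (N u a) (bordered k a v))
             (∑-*ˡ (W v u) λ a → N u a * bordered k a v)) ⟨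
      W v u * N u v * P + -[1+ k ] * ∑ (λ a → W v u * N u a * bordered k a v) ∎
      where
      regroup : ∀ x p c s w → (x * p + c * s) * w ≡ w * x * p + c * (w * s)
      regroup = solve-∀

  principal-suc : ∀ k → principal N (suc (suc k)) ≡
    tr N * principal N (suc k) + -[1+ k ] * weighted N k
  principal-suc k = begin
    ∑ (λ u → bordered (suc k) u u)
      ≡⟨ ∑-cong (λ u → bordered-suc k u u) ⟩
    ∑ (λ u → N u u * P + -[1+ k ] * ∑ λ a → N u a * bordered k a u)
      ≡⟨ ∑-linear -[1+ k ] (λ u → N u u * P) (λ u → ∑ λ a → N u a * bordered k a u) ⟩
    ∑ (λ u → N u u * P) + -[1+ k ] * ∑ (λ u → ∑ λ a → N u a * bordered k a u)
      ≡⟨ cong₂ (λ x y → x + -[1+ k ] * y) (∑-*ʳ P λ u → N u u)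
           (trans (∑-comm λ u a → N u a * bordered k a u)
             (∑-cong λ a → ∑-cong λ u → ℤ.*-comm (N u a) (bordered k a u))) ⟩
    tr N * P + -[1+ k ] * weighted N k ∎
    where P = principal N (suc k)

  principal-one : principal N 1 ≡ tr N
  principal-one = ∑-cong λ u → bordered-zero u u

-- Traces of powers determine the sums of principal minors

SameTraces : ∀ {m n} → Matrix m → Matrix n → Set
SameTraces M M′ = ∀ k → tr (power⁺ M k) ≡ tr (power⁺ M′ k)

weighted-cong : ∀ {n} (N : Matrix n) {W W′ : Matrix n} → W ≐ W′ → ∀ k → weighted N W k ≡ weighted N W′ k
weighted-cong N W≐W′ k = ∑-cong λ u → ∑-cong λ v → cong (_*_ (bordered N k u v)) (W≐W′ v u)

power⁺-step : ∀ {n} (M : Matrix n) j → power⁺ M j ⊛ (M ⊛ M) ≐ power⁺ M (suc (suc j))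
power⁺-step M j i k = sym (⊛-assoc (power⁺ M j) M M i k)

module _ {m n} {M : Matrix m} {M′ : Matrix n} (same : SameTraces M M′) where

  private
    N  = M ⊛ M
    N′ = M′ ⊛ M′

  same-tr-step : ∀ j → tr (power⁺ M j ⊛ N) ≡ tr (power⁺ M′ j ⊛ N′)
  same-tr-step j = trans (tr-cong (power⁺-step M j)) (trans (same (suc (suc j))) (sym (tr-cong (power⁺-step M′ j))))

  -- With a power of `M` as weight, the recursion stays among powers of `M`, the exponent growing by
  -- two because `N` is M². Weights and principal sums are compared by mutual induction on `k`.
  same-weighted : ∀ k j → weighted N (power⁺ M j) k ≡ weighted N′ (power⁺ M′ j) k
  same-principal : ∀ k → principal N (suc k) ≡ principal N′ (suc k)

  same-weighted zero j = trans (weighted-zero N (power⁺ M j)) (trans (same-tr-step j) (sym (weighted-zero N′ (power⁺ M′ j))))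
  same-weighted (suc k) j = begin
    weighted N (power⁺ M j) (suc k)
      ≡⟨ weighted-suc N (power⁺ M j) k ⟩
    tr (power⁺ M j ⊛ N) * principal N (suc k) + -[1+ k ] * weighted N (power⁺ M j ⊛ N) k
      ≡⟨ cong₂ (λ x y → x + -[1+ k ] * y) (cong₂ _*_ (same-tr-step j) (same-principal k)) (trans
           (weighted-cong N (power⁺-step M j) k)
           (trans (same-weighted k (suc (suc j))) (sym (weighted-cong N′ (power⁺-step M′ j) k)))) ⟩
    tr (power⁺ M′ j ⊛ N′) * principal N′ (suc k) + -[1+ k ] * weighted N′ (power⁺ M′ j ⊛ N′) k
      ≡⟨ weighted-suc N′ (power⁺ M′ j) k ⟨
    weighted N′ (power⁺ M′ j) (suc k) ∎

  same-principal zero = trans (principal-one N) (trans (same 1) (sym (principal-one N′)))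
  same-principal (suc k) = begin
    principal N (suc (suc k))
      ≡⟨ principal-suc N k ⟩
    tr N * principal N (suc k) + -[1+ k ] * weighted N N k
      -- `N` is `power⁺ M 1` by definition, so index 1 covers both its trace and its use as a
      -- weight.
      ≡⟨ cong₂ (λ x y → x + -[1+ k ] * y) (cong₂ _*_ (same 1) (same-principal k)) (same-weighted k 1) ⟩
    tr N′ * principal N′ (suc k) + -[1+ k ] * weighted N′ N′ k
      ≡⟨ principal-suc N′ k ⟨
    principal N′ (suc (suc k)) ∎

-- Nonnegative integers

Nonneg : ℤ → Set
Nonneg x = ∃[ k ] x ≡ + k

nonneg-+ : ∀ {x y} → Nonneg x → Nonneg y → Nonneg (x + y)
nonneg-+ (a , refl) (b , refl) = a ℕ.+ b , refl

nonneg-+-zero : ∀ {x y} → Nonneg x → Nonneg y → x + y ≡ 0ℤ → x ≡ 0ℤ × y ≡ 0ℤ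
nonneg-+-zero (zero , refl) (zero , refl) _ = refl , refl

nonneg-square : ∀ x → Nonneg (x * x)
nonneg-square (+ n)    = n ℕ.* n , sym (ℤ.pos-* n n)
nonneg-square -[1+ n ] = suc n ℕ.* suc n , refl

∑-nonneg : ∀ {n} {f : Fin n → ℤ} → (∀ i → Nonneg (f i)) → Nonneg (∑ f)
∑-nonneg {zero}      f≥0 = 0 , ∑-nil
∑-nonneg {suc n} {f} f≥0 = subst Nonneg (sym ∑-suc) (nonneg-+ (f≥0 zero) (∑-nonneg (f≥0 ∘ suc)))

∑-nonneg-zero : ∀ {n} {f : Fin n → ℤ} → (∀ i → Nonneg (f i)) → ∑ f ≡ 0ℤ → ∀ i → f i ≡ 0ℤ
∑-nonneg-zero f≥0 ∑≡0 zero    =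
  proj₁ (nonneg-+-zero (f≥0 zero) (∑-nonneg (f≥0 ∘ suc)) (trans (sym ∑-suc) ∑≡0))
∑-nonneg-zero f≥0 ∑≡0 (suc i) =
  ∑-nonneg-zero (f≥0 ∘ suc) (proj₂ (nonneg-+-zero (f≥0 zero) (∑-nonneg (f≥0 ∘ suc)) (trans (sym ∑-suc) ∑≡0))) i

∑ᵗ-nonneg : ∀ {n} k {F : (Fin k → Fin n) → ℤ} → (∀ I → Nonneg (F I)) → Nonneg (∑ᵗ k F)
∑ᵗ-nonneg zero    F≥0 = F≥0 []
∑ᵗ-nonneg (suc k) F≥0 = ∑-nonneg λ a → ∑ᵗ-nonneg k λ I → F≥0 (a ∷ I)

∑ᵗ-nonneg-zero : ∀ {n} k {F : (Fin k → Fin n) → ℤ} → (∀ {I J} → I ≗ J → F I ≡ F J) →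
  (∀ I → Nonneg (F I)) → ∑ᵗ k F ≡ 0ℤ → ∀ I → F I ≡ 0ℤ
∑ᵗ-nonneg-zero zero    F-cong F≥0 ∑≡0 I = trans (F-cong λ ()) ∑≡0
∑ᵗ-nonneg-zero (suc k) {F} F-cong F≥0 ∑≡0 I = trans
  (F-cong λ { zero → refl ; (suc i) → refl })
  (∑ᵗ-nonneg-zero k {λ J → F (head I ∷ J)} (λ I≗J → F-cong λ { zero → refl ; (suc i) → I≗J i })
    (λ J → F≥0 (head I ∷ J))
    (∑-nonneg-zero (λ a → ∑ᵗ-nonneg k λ J → F≥0 (a ∷ J)) ∑≡0 (head I)) (tail I))

square-zero : ∀ x → x * x ≡ 0ℤ → x ≡ 0ℤ
square-zero (+ zero)  _ = refl
square-zero (+ suc n) ()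
square-zero -[1+ n ]  ()

minors-vanish : ∀ {m n} {M : Matrix m} {M′ : Matrix n} →
  (∀ i j → M i j ≡ M j i) → (∀ i j → M′ i j ≡ M′ j i) → SameTraces M M′ → ∀ k →
  (∀ (I J : Fin (suc k) → Fin n) → Det (λ r c → M′ (I r) (J c)) ≡ 0ℤ) →
  ∀ (I J : Fin (suc k) → Fin m) → Det (λ r c → M (I r) (J c)) ≡ 0ℤ
minors-vanish {M = M} {M′} M-sym M′-sym same k vanish I J = square-zero _
  (∑ᵗ-nonneg-zero (suc k)
    (λ J≗J′ → cong (λ d → d * d) (det-cong λ r c → cong (M (I r)) (J≗J′ c)))
    (λ J → nonneg-square (Det λ r c → M (I r) (J c)))
    (∑ᵗ-nonneg-zero (suc k)
      (λ I≗I′ → ∑ᵗ-cong (suc k) λ J → cong (λ d → d * d) (det-cong λ r c → cong (λ i → M i (J c)) (I≗I′ r)))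
      (λ I → ∑ᵗ-nonneg (suc k) λ J → nonneg-square (Det λ r c → M (I r) (J c)))
      total I) J)
  where
  zeros : ∀ {n} k {F : (Fin k → Fin n) → ℤ} → (∀ I → F I ≡ 0ℤ) → ∑ᵗ k F ≡ 0ℤ
  zeros zero    F≡0 = F≡0 []
  zeros (suc k) F≡0 = ∑-zero λ a → zeros k λ I → F≡0 (a ∷ I)
  total : ∑ᵗ (suc k) (λ I → ∑ᵗ (suc k) λ J → Det (λ r c → M (I r) (J c)) * Det (λ r c → M (I r) (J c))) ≡ 0ℤ
  total = begin
    ∑ᵗ (suc k) (λ I → ∑ᵗ (suc k) λ J → Det (λ r c → M (I r) (J c)) * Det (λ r c → M (I r) (J c)))
      ≡⟨ sum-of-squared-minors M M-sym k ⟩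
    + (suc k !) * principal (M ⊛ M) (suc k)
      ≡⟨ cong (_*_ (+ (suc k !))) (same-principal same k) ⟩
    + (suc k !) * principal (M′ ⊛ M′) (suc k)
      ≡⟨ sum-of-squared-minors M′ M′-sym k ⟨
    ∑ᵗ (suc k) (λ I → ∑ᵗ (suc k) λ J → Det (λ r c → M′ (I r) (J c)) * Det (λ r c → M′ (I r) (J c)))
      ≡⟨ zeros (suc k) (λ I → zeros (suc k) λ J → cong (λ d → d * d) (vanish I J)) ⟩
    0ℤ ∎

-- Newton's identities: the reversed characteristic polynomial determines the traces

-- The derivative of the determinant at `A` in the direction `B`, one row being replaced at a time.
-- The new row stands in front with the compensating sign, so that the other rows are simply
-- `A ∘ punchIn i`.
det-derivative : ∀ {n} → Matrix n → Matrix n → ℤ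
det-derivative {zero}  A B = 0ℤ
det-derivative {suc n} A B = ∑ λ i → sign i * Det (B i ∷ A ∘ punchIn i)

-- The product rule for the expansion along row zero: differentiating the entry yields the summand
-- of row zero, differentiating the minors yields the other rows, each after a swap with row zero.
det-derivative-expand : ∀ {n} (A B : Matrix (suc n)) →
  ∑ (λ j → sign j * (B zero j * Det (minor j (tail A)) + A zero j * det-derivative (minor j (tail A)) (minor j (tail B)))) ≡
  det-derivative A B
det-derivative-expand {n} A B = begin
  ∑ (λ j → sign j * (B zero j * Det (minor j (tail A)) + A zero j * det-derivative (minor j (tail A)) (minor j (tail B))))
    ≡⟨ ∑-cong (λ j → ℤ.*-distribˡ-+ (sign j) (B zero j * Det (minor j (tail A))) (A zero j * det-derivative (minor j (tail A)) (minor j (tail B)))) ⟩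
  ∑ (λ j → sign j * (B zero j * Det (minor j (tail A))) + sign j * (A zero j * det-derivative (minor j (tail A)) (minor j (tail B))))
    ≡⟨ ∑-+ (λ j → sign j * (B zero j * Det (minor j (tail A)))) (λ j → sign j * (A zero j * det-derivative (minor j (tail A)) (minor j (tail B)))) ⟩
  ∑ (λ j → sign j * (B zero j * Det (minor j (tail A)))) + ∑ (λ j → sign j * (A zero j * det-derivative (minor j (tail A)) (minor j (tail B))))
    ≡⟨ cong₂ _+_ (trans (sym (det-expand (B zero ∷ tail A))) (sym (ℤ.*-identityˡ (Det (B zero ∷ tail A))))) (others A B) ⟩
  1ℤ * Det (B zero ∷ tail A) + ∑ (λ i → (-1ℤ * sign i) * Det (B (suc i) ∷ A ∘ punchIn (suc i)))
    ≡⟨ ∑-suc ⟨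
  det-derivative A B ∎
  where
  others : ∀ {n} (A B : Matrix (suc n)) →
    ∑ (λ j → sign j * (A zero j * det-derivative (minor j (tail A)) (minor j (tail B)))) ≡
    ∑ (λ i → (-1ℤ * sign i) * Det (B (suc i) ∷ A ∘ punchIn (suc i)))
  others {zero}  A B = trans (∑-zero λ j → trans (cong (_*_ (sign j)) (ℤ.*-zeroʳ (A zero j))) (ℤ.*-zeroʳ (sign j))) (sym ∑-nil)
  others {suc n} A B = begin
    ∑ (λ j → sign j * (A zero j * ∑ λ i → sign i * d i j))
      ≡⟨ ∑-cong (λ j → trans (∑-*ˡ (sign j) λ i → A zero j * (sign i * d i j)) (cong (_*_ (sign j)) (∑-*ˡ (A zero j) λ i → sign i * d i j))) ⟨
    ∑ (λ j → ∑ λ i → sign j * (A zero j * (sign i * d i j)))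
      ≡⟨ ∑-comm (λ j i → sign j * (A zero j * (sign i * d i j))) ⟩
    ∑ (λ i → ∑ λ j → sign j * (A zero j * (sign i * d i j)))
      ≡⟨ ∑-cong (λ i → begin
           ∑ (λ j → sign j * (A zero j * (sign i * d i j)))
             ≡⟨ ∑-cong (λ j → pull (sign j) (A zero j) (sign i) (d i j)) ⟩
           ∑ (λ j → sign i * (sign j * (A zero j * d i j)))
             ≡⟨ ∑-*ˡ (sign i) (λ j → sign j * (A zero j * d i j)) ⟩
           sign i * ∑ (λ j → sign j * (A zero j * d i j))
             ≡⟨ cong (_*_ (sign i)) (trans
                  (det-expand (A zero ∷ B (suc i) ∷ tail A ∘ punchIn i))
                  (∑-cong λ j → cong (λ z → sign j * (A zero j * z)) (det-cong λ { zero k → refl ; (suc r) k → refl }))) ⟨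
           sign i * Det (A zero ∷ B (suc i) ∷ tail A ∘ punchIn i)
             ≡⟨ cong (_*_ (sign i)) (det-swap (A zero) (B (suc i)) (tail A ∘ punchIn i)) ⟩
           sign i * - Det (B (suc i) ∷ A zero ∷ tail A ∘ punchIn i)
             ≡⟨ -*-swap (sign i) (Det (B (suc i) ∷ A zero ∷ tail A ∘ punchIn i)) ⟩
           (-1ℤ * sign i) * Det (B (suc i) ∷ A zero ∷ tail A ∘ punchIn i)
             ≡⟨ cong (_*_ (-1ℤ * sign i)) (det-cong λ { zero k → refl ; (suc zero) k → refl ; (suc (suc r)) k → refl }) ⟩
           (-1ℤ * sign i) * Det (B (suc i) ∷ A ∘ punchIn (suc i)) ∎) ⟩
    ∑ (λ i → (-1ℤ * sign i) * Det (B (suc i) ∷ A ∘ punchIn (suc i))) ∎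
    where
    d : Fin (suc n) → Fin (suc (suc n)) → ℤ
    d i j = Det (minor j (tail B) i ∷ minor j (tail A) ∘ punchIn i)
    pull : ∀ s x t y → s * (x * (t * y)) ≡ t * (s * (x * y))
    pull = solve-∀

-- The remainder is an explicit integer multiple of `h * h`, so that derivatives can be extracted by
-- divisibility.
det-perturb : ∀ {n} h (A B : Matrix n) →
  ∃[ r ] Det (λ i j → A i j + h * B i j) ≡ Det A + h * det-derivative A B + h * h * r
det-perturb {zero}  h A B = 0ℤ , trans (det-cong λ ()) (pad (Det A) h)
  where
  pad : ∀ x h → x ≡ x + h * 0ℤ + h * h * 0ℤ
  pad = solve-∀
det-perturb {suc n} h A B = ∑ rest , (begin
  Det (λ i j → A i j + h * B i j)
    ≡⟨ det-expand (λ i j → A i j + h * B i j) ⟩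
  ∑ (λ j → sign j * ((A zero j + h * B zero j) * Det (λ i k → minor j (tail A) i k + h * minor j (tail B) i k)))
    ≡⟨ ∑-cong (λ j → trans
         (cong (λ z → sign j * ((A zero j + h * B zero j) * z)) (proj₂ (det-perturb h (minor j (tail A)) (minor j (tail B)))))
         (regroup (sign j) h (A zero j) (B zero j) (d j) (d′ j) (r j))) ⟩
  ∑ (λ j → sign j * (A zero j * d j) + h * (sign j * (B zero j * d j + A zero j * d′ j)) + h * h * rest j)
    ≡⟨ ∑-linear (h * h) (λ j → sign j * (A zero j * d j) + h * (sign j * (B zero j * d j + A zero j * d′ j))) rest ⟩
  ∑ (λ j → sign j * (A zero j * d j) + h * (sign j * (B zero j * d j + A zero j * d′ j))) + h * h * ∑ rest
    ≡⟨ cong (_+ h * h * ∑ rest) (∑-linear h (λ j → sign j * (A zero j * d j)) (λ j → sign j * (B zero j * d j + A zero j * d′ j))) ⟩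
  ∑ (λ j → sign j * (A zero j * d j)) + h * ∑ (λ j → sign j * (B zero j * d j + A zero j * d′ j)) + h * h * ∑ rest
    ≡⟨ cong₂ (λ x y → x + h * y + h * h * ∑ rest) (sym (det-expand A)) (det-derivative-expand A B) ⟩
  Det A + h * det-derivative A B + h * h * ∑ rest ∎)
  where
  d d′ r rest : Fin (suc n) → ℤ
  d j = Det (minor j (tail A))
  d′ j = det-derivative (minor j (tail A)) (minor j (tail B))
  r j = proj₁ (det-perturb h (minor j (tail A)) (minor j (tail B)))
  rest j = sign j * (A zero j * r j + B zero j * d′ j + h * (B zero j * r j))
  regroup : ∀ s h a b d e r → s * ((a + h * b) * (d + h * e + h * h * r)) ≡
    s * (a * d) + h * (s * (b * d + a * e)) + h * h * (s * (a * r + b * e + h * (b * r)))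
  regroup = solve-∀

identity-off : ∀ {n} {i j : Fin n} → i ≢ j → identity i j ≡ 0ℤ
identity-off {i = i} {j} i≢j with i ≟ᶠ j
... | yes i≡j = contradiction i≡j i≢j
... | no  _   = refl

identity-diag : ∀ {n} (i : Fin n) → identity i i ≡ 1ℤ
identity-diag i with i ≟ᶠ i
... | yes _  = refl
... | no i≢i = contradiction refl i≢i

det-identity : ∀ n → Det {n} identity ≡ 1ℤ
det-identity zero    = det-nil identity
det-identity (suc n) = begin
  Det identity
    ≡⟨ det-expand identity ⟩
  ∑ (λ j → sign j * (identity zero j * Det (minor j (tail identity))))
    ≡⟨ ∑-single zero (λ j → zero-product (sign (suc j)) (Det (minor (suc j) (tail identity)))) ⟩
  1ℤ * (1ℤ * Det (minor zero (tail identity)))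
    ≡⟨ trans (ℤ.*-identityˡ (1ℤ * Det (minor zero (tail identity)))) (ℤ.*-identityˡ (Det (minor zero (tail identity)))) ⟩
  Det (minor zero (tail identity))
    ≡⟨ trans (det-cong λ i j → refl) (det-identity n) ⟩
  1ℤ ∎
  where
  zero-product : ∀ s d → s * (0ℤ * d) ≡ 0ℤ
  zero-product = solve-∀

⊛-identity : ∀ {k n} (A : Rows k n) → A ⊛ identity ≐ A
⊛-identity {n = suc n} A i j = begin
  ∑ (λ l → A i l * identity l j)
    ≡⟨ ∑-single j (λ l → trans (cong (_*_ (A i (punchIn j l))) (identity-off (Fin.punchInᵢ≢i j l))) (ℤ.*-zeroʳ (A i (punchIn j l)))) ⟩
  A i j * identity j j
    ≡⟨ trans (cong (_*_ (A i j)) (identity-diag j)) (ℤ.*-identityʳ (A i j)) ⟩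
  A i j ∎

I-_·_ : ∀ {n} → ℤ → Matrix n → Matrix n
(I- y · M) i j = identity i j + - y * M i j

reversed : ∀ {n} → Matrix n → ℤ → ℤ
reversed M y = Det (I- y · M)

module _ {n} (M : Matrix n) where

  -- This is tr (adj (I - yM) M^(k+1)); for k = 0 it is minus the derivative of `reversed M` at `y`.
  newton-sum : ℤ → ℕ → ℤ
  newton-sum y k = det-derivative (I- y · M) (power⁺ M k)

  reversed-step : ∀ y h → ∃[ r ] reversed M (y - h) ≡ reversed M y + h * newton-sum y 0 + h * h * r
  reversed-step y h = let (r , eq) = det-perturb h (I- y · M) M in
    r , trans (det-cong λ i j → regroup (identity i j) y h (M i j)) eq
    where
    regroup : ∀ d y h m → d + - (y - h) * m ≡ d + - y * m + h * m
    regroup = solve-∀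

  reversed-one : ∀ y → ∃[ r ] reversed M y ≡ 1ℤ + y * r
  reversed-one y = let (r , eq) = det-perturb (- y) identity M; g = det-derivative identity M in
    - g + y * r , trans eq (trans (cong (λ d → d + - y * g + - y * - y * r) (det-identity n)) (factor y g r))
    where
    factor : ∀ y g r → 1ℤ + - y * g + - y * - y * r ≡ 1ℤ + y * (- g + y * r)
    factor = solve-∀

-- With A = I - yM and W = M^(k+1) one has W = WA + yWM. When row i of A is replaced by row i of WA,
-- only its component along row i of A survives, since every other row of A is repeated; these terms
-- add up to tr W times det A.
newton : ∀ {n} (M : Matrix n) y k →
  newton-sum M y k ≡ tr (power⁺ M k) * reversed M y + y * newton-sum M y (suc k)
newton {zero}  M y k = sym (trans (cong (λ t → t * reversed M y + y * 0ℤ) ∑-nil) (cong (_+_ 0ℤ) (ℤ.*-zeroʳ y)))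
newton {suc n} M y k = begin
  ∑ (λ i → sign i * Det (W i ∷ A ∘ punchIn i))
    ≡⟨ ∑-cong (λ i → begin
         sign i * Det (W i ∷ A ∘ punchIn i)
           ≡⟨ cong (_*_ (sign i)) (det-cong λ { zero j → W-split i j ; (suc r) j → refl }) ⟩
         sign i * Det ((λ j → (W ⊛ A) i j + y * W′ i j) ∷ A ∘ punchIn i)
           ≡⟨ cong (_*_ (sign i)) (det-linear y ((W ⊛ A) i) (W′ i) (A ∘ punchIn i)) ⟩
         sign i * (Det ((W ⊛ A) i ∷ A ∘ punchIn i) + y * Det (W′ i ∷ A ∘ punchIn i))
           ≡⟨ cong (λ z → sign i * (z + y * Det (W′ i ∷ A ∘ punchIn i))) (trans (linear-∑ (W i) A (A ∘ punchIn i))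
                (∑-single i λ l → trans (cong (_*_ (W i (punchIn i l))) (repeated i l)) (ℤ.*-zeroʳ (W i (punchIn i l))))) ⟩
         sign i * (W i i * Det (A i ∷ A ∘ punchIn i) + y * Det (W′ i ∷ A ∘ punchIn i))
           ≡⟨ regroup (sign i) (W i i) (Det (A i ∷ A ∘ punchIn i)) y (Det (W′ i ∷ A ∘ punchIn i)) ⟩
         W i i * (sign i * Det (A i ∷ A ∘ punchIn i)) + y * (sign i * Det (W′ i ∷ A ∘ punchIn i))
           ≡⟨ cong (λ z → W i i * z + y * (sign i * Det (W′ i ∷ A ∘ punchIn i))) (det-move i A) ⟨
         W i i * Det A + y * (sign i * Det (W′ i ∷ A ∘ punchIn i)) ∎) ⟩
  ∑ (λ i → W i i * Det A + y * (sign i * Det (W′ i ∷ A ∘ punchIn i)))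
    ≡⟨ ∑-linear y (λ i → W i i * Det A) (λ i → sign i * Det (W′ i ∷ A ∘ punchIn i)) ⟩
  ∑ (λ i → W i i * Det A) + y * newton-sum M y (suc k)
    ≡⟨ cong (_+ y * newton-sum M y (suc k)) (∑-*ʳ (Det A) λ i → W i i) ⟩
  tr W * Det A + y * newton-sum M y (suc k) ∎
  where
  open Alternating det-alternating using (linear-∑)
  A = I- y · M
  W = power⁺ M k
  W′ = power⁺ M (suc k)
  regroup : ∀ s w d y e → s * (w * d + y * e) ≡ w * (s * d) + y * (s * e)
  regroup = solve-∀
  repeated : ∀ i l → Det (A (punchIn i l) ∷ A ∘ punchIn i) ≡ 0ℤ
  repeated = go A
    where
    go : ∀ {n} (A : Matrix (suc n)) i l → Det (A (punchIn i l) ∷ A ∘ punchIn i) ≡ 0ℤ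
    go {suc n} A i l = repeated-row det-alternating l (A ∘ punchIn i)
  W-split : ∀ i j → W i j ≡ (W ⊛ A) i j + y * W′ i j
  W-split i j = begin
    W i j
      ≡⟨ cancel (W i j) y (W′ i j) ⟩
    W i j + - y * W′ i j + y * W′ i j
      ≡⟨ cong (_+ y * W′ i j) (begin
           W i j + - y * W′ i j
             ≡⟨ cong (_+ - y * W′ i j) (⊛-identity W i j) ⟨
           (W ⊛ identity) i j + - y * W′ i j
             ≡⟨ ∑-linear (- y) (λ l → W i l * identity l j) (λ l → W i l * M l j) ⟨
           ∑ (λ l → W i l * identity l j + - y * (W i l * M l j))
             ≡⟨ ∑-cong (λ l → factor (W i l) (identity l j) y (M l j)) ⟩
           (W ⊛ A) i j ∎) ⟩
    (W ⊛ A) i j + y * W′ i j ∎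
    where
    cancel : ∀ w y v → w ≡ w + - y * v + y * v
    cancel = solve-∀
    factor : ∀ w d y m → w * d + - y * (w * m) ≡ w * (d + - y * m)
    factor = solve-∀

-- The difference d is divisible by |d| + 1, hence zero. Congruence modulo every positive integer
-- replaces a limit: it reads off a derivative, or a value at 0.
agree : ∀ {x x′} → (∀ n → ∃[ r ] ∃[ r′ ] x + + suc n * r ≡ x′ + + suc n * r′) → x ≡ x′
agree {x} {x′} cong-mod = ℤ.i-j≡0⇒i≡j x x′ (divisible (x - x′) λ n →
  let (r , r′ , eq) = cong-mod n in r′ - r , subtract x x′ (+ suc n) r r′ eq)
  where
  rearrange₁ : ∀ x x′ h r → x - x′ ≡ (x + h * r) - (x′ + h * r)
  rearrange₁ = solve-∀
  rearrange₂ : ∀ x′ h r r′ → (x′ + h * r′) - (x′ + h * r) ≡ h * (r′ - r)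
  rearrange₂ = solve-∀
  subtract : ∀ x x′ h r r′ → x + h * r ≡ x′ + h * r′ → x - x′ ≡ h * (r′ - r)
  subtract x x′ h r r′ eq = trans (rearrange₁ x x′ h r) (trans (cong (_- (x′ + h * r)) eq) (rearrange₂ x′ h r r′))
  divisible : ∀ d → (∀ n → ∃[ q ] d ≡ + suc n * q) → d ≡ 0ℤ
  divisible d div = let (q , eq) = div ∣ d ∣ in ℤ.∣i∣≡0⇒i≡0 (small ∣ d ∣ ∣ q ∣ (trans (cong ∣_∣ eq) (ℤ.abs-* (+ suc ∣ d ∣) q)))
    where
    small : ∀ a b → a ≡ suc a ℕ.* b → a ≡ 0
    small a zero    eq = trans eq (ℕ.*-zeroʳ (suc a))
    small a (suc b) eq = contradiction (ℕ.≤-reflexive (sym eq)) (ℕ.<⇒≱ (ℕ.m≤m*n (suc a) (suc b)))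

+-cancelˡ : ∀ x {y z} → x + y ≡ x + z → y ≡ z
+-cancelˡ x {y} {z} eq = trans (sym (drop x y)) (trans (cong (_+_ (- x)) eq) (drop x z))
  where
  drop : ∀ x y → - x + (x + y) ≡ y
  drop = solve-∀

-- Newton sums and traces are obtained alternately. Equal Newton sums for k make the traces for k
-- congruent modulo every y > 0, because `reversed` is 1 modulo y; given those traces, `newton` can
-- be solved for the Newton sum k + 1, as y can be cancelled.
reversed-determines-traces : ∀ {m n} (M : Matrix m) (M′ : Matrix n) →
  (∀ y → reversed M y ≡ reversed M′ y) → SameTraces M M′
reversed-determines-traces M M′ same = trace
  where
  newton-sums : ∀ k p → newton-sum M (+ suc p) k ≡ newton-sum M′ (+ suc p) k
  trace : ∀ k → tr (power⁺ M k) ≡ tr (power⁺ M′ k)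

  -- Comparing the expansions at `y - h` and cancelling one `h` leaves the derivatives congruent
  -- modulo `h`, for every positive `h`.
  newton-sums zero p = agree λ n →
    let y = + suc p
        h = + suc n
        (r , eq)   = reversed-step M y h
        (r′ , eq′) = reversed-step M′ y h
    in r , r′ , ℤ.*-cancelˡ-≡ h _ _ (+-cancelˡ (reversed M y) (begin
      reversed M y + h * (newton-sum M y 0 + h * r)
        ≡⟨ regroup (reversed M y) h (newton-sum M y 0) r ⟩
      reversed M y + h * newton-sum M y 0 + h * h * r
        ≡⟨ trans (sym eq) (trans (same (y - h)) eq′) ⟩
      reversed M′ y + h * newton-sum M′ y 0 + h * h * r′
        ≡⟨ regroup (reversed M′ y) h (newton-sum M′ y 0) r′ ⟨
      reversed M′ y + h * (newton-sum M′ y 0 + h * r′)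
        ≡⟨ cong (_+ h * (newton-sum M′ y 0 + h * r′)) (same y) ⟨
      reversed M y + h * (newton-sum M′ y 0 + h * r′) ∎))
    where
    regroup : ∀ x h g r → x + h * (g + h * r) ≡ x + h * g + h * h * r
    regroup = solve-∀
  newton-sums (suc k) p = ℤ.*-cancelˡ-≡ y _ _ (+-cancelˡ (tr (power⁺ M k) * reversed M y) (begin
    tr (power⁺ M k) * reversed M y + y * newton-sum M y (suc k)
      ≡⟨ newton M y k ⟨
    newton-sum M y k
      ≡⟨ newton-sums k p ⟩
    newton-sum M′ y k
      ≡⟨ newton M′ y k ⟩
    tr (power⁺ M′ k) * reversed M′ y + y * newton-sum M′ y (suc k)
      ≡⟨ cong (_+ y * newton-sum M′ y (suc k)) (cong₂ _*_ (trace k) (same y)) ⟨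
    tr (power⁺ M k) * reversed M y + y * newton-sum M′ y (suc k) ∎))
    where y = + suc p

  trace k = agree λ n →
    let y = + suc n
        (r , eq)   = reversed-one M y
        (r′ , eq′) = reversed-one M′ y
        t  = tr (power⁺ M k)
        t′ = tr (power⁺ M′ k)
    in t * r + newton-sum M y (suc k) , t′ * r′ + newton-sum M′ y (suc k) , (begin
      t + y * (t * r + newton-sum M y (suc k))
        ≡⟨ regroup t y r (newton-sum M y (suc k)) ⟩
      t * (1ℤ + y * r) + y * newton-sum M y (suc k)
        ≡⟨ cong (λ z → t * z + y * newton-sum M y (suc k)) eq ⟨
      t * reversed M y + y * newton-sum M y (suc k)
        ≡⟨ trans (sym (newton M y k)) (trans (newton-sums k n) (newton M′ y k)) ⟩
      t′ * reversed M′ y + y * newton-sum M′ y (suc k)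
        ≡⟨ cong (λ z → t′ * z + y * newton-sum M′ y (suc k)) eq′ ⟩
      t′ * (1ℤ + y * r′) + y * newton-sum M′ y (suc k)
        ≡⟨ regroup t′ y r′ (newton-sum M′ y (suc k)) ⟨
      t′ + y * (t′ * r′ + newton-sum M′ y (suc k)) ∎)
    where
    regroup : ∀ t y r g → t + y * (t * r + g) ≡ t * (1ℤ + y * r) + y * g
    regroup = solve-∀

-- Comparison of ℤ with a field of characteristic zero

module NaturalDifference {c ℓ} (R : CommutativeRing c ℓ) where
  private
    module R = CommutativeRing R
    open SemiringSolver R.commutativeSemiring using (solve; _:+_; _:*_; _:=_)
    open SemiringMult R.semiring using (×-homo-+; ×1-homo-*)
    open SetoidReasoning R.setoid renaming (begin_ to begin≈_; _∎ to _∎≈)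
  open Determinant R public using (_·_)

  -- x is the image of the integer a - b.
  record Rep (x : R.Carrier) (a b : ℕ) : Set ℓ where
    constructor rep
    field balance : x R.+ b · R.1# R.≈ a · R.1#

  rep-cong : ∀ {x y a b} → x R.≈ y → Rep x a b → Rep y a b
  rep-cong x≈y (rep p) = rep (R.trans (R.+-congʳ (R.sym x≈y)) p)

  rep-nat : ∀ n → Rep (n · R.1#) n 0
  rep-nat n = rep (R.+-identityʳ (n · R.1#))

  rep-neg : ∀ {x a b} → Rep x a b → Rep (R.- x) b a
  rep-neg {x} {a} {b} (rep p) = rep (R.trans (R.+-congˡ (R.sym p))
    (R.trans (R.sym (R.+-assoc (R.- x) x (b · R.1#)))
      (R.trans (R.+-congʳ (R.-‿inverseˡ x)) (R.+-identityˡ (b · R.1#)))))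

  rep-+ : ∀ {x y a b a′ b′} → Rep x a b → Rep y a′ b′ → Rep (x R.+ y) (a ℕ.+ a′) (b ℕ.+ b′)
  rep-+ {x} {y} {a} {b} {a′} {b′} (rep p) (rep q) = rep (begin≈
    x R.+ y R.+ (b ℕ.+ b′) · R.1#
      ≈⟨ R.+-congˡ (×-homo-+ R.1# b b′) ⟩
    x R.+ y R.+ (b · R.1# R.+ b′ · R.1#)
      ≈⟨ solve 4 (λ x y b b′ → (x :+ y) :+ (b :+ b′) := (x :+ b) :+ (y :+ b′)) R.refl x y (b · R.1#) (b′ · R.1#) ⟩
    (x R.+ b · R.1#) R.+ (y R.+ b′ · R.1#)
      ≈⟨ R.+-cong p q ⟩
    a · R.1# R.+ a′ · R.1#
      ≈⟨ ×-homo-+ R.1# a a′ ⟨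
    (a ℕ.+ a′) · R.1# ∎≈)

  rep-* : ∀ {x y a b a′ b′} → Rep x a b → Rep y a′ b′ →
    Rep (x R.* y) (a ℕ.* a′ ℕ.+ b ℕ.* b′) (a ℕ.* b′ ℕ.+ b ℕ.* a′)
  rep-* {x} {y} {a} {b} {a′} {b′} (rep p) (rep q) = rep (begin≈
    x R.* y R.+ (a ℕ.* b′ ℕ.+ b ℕ.* a′) · R.1#
      ≈⟨ R.+-congˡ (homo a b′ b a′) ⟩
    x R.* y R.+ (â R.* b̂′ R.+ b̂ R.* â′)
      ≈⟨ R.+-congˡ (R.+-cong (R.*-congʳ (R.sym p)) (R.*-congˡ (R.sym q))) ⟩
    x R.* y R.+ ((x R.+ b̂) R.* b̂′ R.+ b̂ R.* (y R.+ b̂′))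
      ≈⟨ solve 4 (λ x y b b′ → (x :* y) :+ ((x :+ b) :* b′ :+ b :* (y :+ b′)) := (x :+ b) :* (y :+ b′) :+ b :* b′) R.refl x y b̂ b̂′ ⟩
    (x R.+ b̂) R.* (y R.+ b̂′) R.+ b̂ R.* b̂′
      ≈⟨ R.+-congʳ (R.*-cong p q) ⟩
    â R.* â′ R.+ b̂ R.* b̂′
      ≈⟨ homo a a′ b b′ ⟨
    (a ℕ.* a′ ℕ.+ b ℕ.* b′) · R.1# ∎≈)
    where
    â = a · R.1#
    b̂ = b · R.1#
    â′ = a′ · R.1#
    b̂′ = b′ · R.1#
    homo : ∀ i j k l → (i ℕ.* j ℕ.+ k ℕ.* l) · R.1# R.≈ i · R.1# R.* j · R.1# R.+ k · R.1# R.* l · R.1#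
    homo i j k l = R.trans (×-homo-+ R.1# (i ℕ.* j) (k ℕ.* l)) (R.+-cong (×1-homo-* i j) (×1-homo-* k l))

  rep-sum : ∀ {x y a b a′ b′} → Rep x a b → Rep y a′ b′ → x R.+ (a′ ℕ.+ b) · R.1# R.≈ y R.+ (a ℕ.+ b′) · R.1#
  rep-sum {x} {y} {a} {b} {a′} {b′} (rep p) (rep q) = begin≈
    x R.+ (a′ ℕ.+ b) · R.1#
      ≈⟨ R.+-congˡ (×-homo-+ R.1# a′ b) ⟩
    x R.+ (a′ · R.1# R.+ b · R.1#)
      ≈⟨ R.+-congˡ (R.+-congʳ (R.sym q)) ⟩
    x R.+ ((y R.+ b′ · R.1#) R.+ b · R.1#)
      ≈⟨ solve 4 (λ x y b b′ → x :+ ((y :+ b′) :+ b) := y :+ ((x :+ b) :+ b′)) R.refl x y (b · R.1#) (b′ · R.1#) ⟩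
    y R.+ ((x R.+ b · R.1#) R.+ b′ · R.1#)
      ≈⟨ R.+-congˡ (R.+-congʳ p) ⟩
    y R.+ (a · R.1# R.+ b′ · R.1#)
      ≈⟨ R.+-congˡ (×-homo-+ R.1# a b′) ⟨
    y R.+ (a ℕ.+ b′) · R.1# ∎≈

module DeterminantProperties {c ℓ} (R : CommutativeRing c ℓ) where
  private
    module R = CommutativeRing R
    module SumR = Algebra.Properties.Semiring.Sum R.semiring
    open SemiringSolver R.commutativeSemiring using (solve; _:*_; _:=_)
    open SetoidReasoning R.setoid renaming (begin_ to begin≈_; _∎ to _∎≈)
  open Determinant R using () renaming (Matrix to Matrixᴿ; det to detᴿ; sum to sumᴿ; _^_ to _^ᴿ_)

  det-cong≈ : ∀ {n} {A B : Matrixᴿ n} → (∀ i j → A i j R.≈ B i j) → detᴿ A R.≈ detᴿ B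
  det-cong≈ {zero}  A≈B = R.refl
  det-cong≈ {suc n} A≈B = SumR.sum-cong-≋ λ j → R.*-congˡ {(R.- R.1#) ^ᴿ toℕ j} (R.*-cong (A≈B zero j) (det-cong≈ λ i k → A≈B (suc i) (punchIn j k)))

  det-scale : ∀ {n} u (A : Matrixᴿ n) → detᴿ (λ i j → u R.* A i j) R.≈ u ^ᴿ n R.* detᴿ A
  det-scale {zero}  u A = R.sym (R.*-identityˡ R.1#)
  det-scale {suc n} u A = begin≈
    detᴿ (λ i j → u R.* A i j)
      ≈⟨ SumR.sum-cong-≋ (λ j → R.trans
           (R.*-congˡ (R.*-congˡ (det-scale u (λ i k → A (suc i) (punchIn j k)))))
           (solve 5 (λ s u x p d → s :* ((u :* x) :* (p :* d)) := (u :* p) :* (s :* (x :* d))) R.refl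
             ((R.- R.1#) ^ᴿ toℕ j) u (A zero j) (u ^ᴿ n) (detᴿ λ i k → A (suc i) (punchIn j k)))) ⟩
    sumᴿ (λ j → (u R.* u ^ᴿ n) R.* (((R.- R.1#) ^ᴿ toℕ j) R.* (A zero j R.* detᴿ λ i k → A (suc i) (punchIn j k))))
      ≈⟨ SumR.*-distribˡ-sum (u R.* u ^ᴿ n) (λ j → ((R.- R.1#) ^ᴿ toℕ j) R.* (A zero j R.* detᴿ λ i k → A (suc i) (punchIn j k))) ⟨
    (u ^ᴿ suc n) R.* detᴿ A ∎≈

module _ {c ℓ} (R : CommutativeRing c ℓ) where
  private
    module R = CommutativeRing R
    module ℤᵈ = NaturalDifference ℤ.+-*-commutativeRing
    module Rᵈ = NaturalDifference R
    open RingProperties R.ring using (+-cancelʳ)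
    module DetR = Determinant R
    module MultR = SemiringMult R.semiring
    open DetR using (_·_)

  -- The integer and the ring element share one representation as a difference of naturals. This
  -- relation is preserved by the ring operations and hence by `det`; characteristic zero enters
  -- only when it is inverted in `image-injective`.
  record Image (z : ℤ) (x : R.Carrier) : Set ℓ where
    constructor image
    field
      positive negative : ℕ
      repℤ : ℤᵈ.Rep z positive negative
      repᴿ : Rᵈ.Rep x positive negative

  image-cong : ∀ {z x y} → x R.≈ y → Image z x → Image z y
  image-cong x≈y (image a b p q) = image a b p (Rᵈ.rep-cong x≈y q)

  image-+ : ∀ {z w x y} → Image z x → Image w y → Image (z + w) (x R.+ y)
  image-+ (image a b p q) (image a′ b′ p′ q′) =
    image (a ℕ.+ a′) (b ℕ.+ b′) (ℤᵈ.rep-+ p p′) (Rᵈ.rep-+ q q′)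

  image-* : ∀ {z w x y} → Image z x → Image w y → Image (z * w) (x R.* y)
  image-* (image a b p q) (image a′ b′ p′ q′) =
    image (a ℕ.* a′ ℕ.+ b ℕ.* b′) (a ℕ.* b′ ℕ.+ b ℕ.* a′) (ℤᵈ.rep-* p p′) (Rᵈ.rep-* q q′)

  image-neg : ∀ {z x} → Image z x → Image (- z) (R.- x)
  image-neg (image a b p q) = image b a (ℤᵈ.rep-neg p) (Rᵈ.rep-neg q)

  image-nat : ∀ n → Image (+ n) (n · R.1#)
  image-nat n = image n 0 (subst (λ z → ℤᵈ.Rep z n 0) (×1≡ n) (ℤᵈ.rep-nat n)) (Rᵈ.rep-nat n)
    where
    ×1≡ : ∀ n → n ℤᵈ.· 1ℤ ≡ + n
    ×1≡ zero    = refl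
    ×1≡ (suc n) = cong (_+_ 1ℤ) (×1≡ n)

  image-0 : Image 0ℤ R.0#
  image-0 = image-nat 0

  image-1 : Image 1ℤ R.1#
  image-1 = image-cong (R.+-identityʳ R.1#) (image-nat 1)

  image-any : ∀ z → ∃[ x ] Image z x
  image-any (+ n)    = n · R.1# , image-nat n
  image-any -[1+ n ] = R.- (suc n · R.1#) , image-neg (image-nat (suc n))

  image-^ : ∀ {z x} k → Image z x → Image (z ^ k) (x DetR.^ k)
  image-^ zero    i = image-1
  image-^ (suc k) i = image-* i (image-^ k i)

  image-sum : ∀ {n} {f : Fin n → ℤ} {g} → (∀ i → Image (f i) (g i)) → Image (sum f) (DetR.sum g)
  image-sum {zero}  i = image-0
  image-sum {suc n} i = image-+ (i zero) (image-sum (i ∘ suc))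

  image-det : ∀ {n} {A : Matrix n} {B} → (∀ i j → Image (A i j) (B i j)) → Image (det A) (DetR.det B)
  image-det {zero}  i = image-1
  image-det {suc n} i = image-sum λ j →
    image-* (image-^ (toℕ j) (image-neg image-1)) (image-* (i zero j) (image-det λ r k → i (suc r) (punchIn j k)))

  image-identity : ∀ {n} (i j : Fin n) → Image (identity i j) (DetR.identity i j)
  image-identity i j with i ≟ᶠ j
  ... | yes _ = image-1
  ... | no  _ = image-0

  module _ (char-zero : ∀ k → k · R.1# R.≈ R.0# → k ≡ 0) where

    ·1-injective-≤ : ∀ {p q} → p ≤ q → p · R.1# R.≈ q · R.1# → p ≡ q
    ·1-injective-≤ {p} p≤q eq with (d , refl) ← ℕ.m≤n⇒∃[o]m+o≡n p≤q =
      sym (trans (cong (p ℕ.+_) (char-zero d (+-cancelʳ (p · R.1#) (d · R.1#) R.0# (R.trans (R.+-comm (d · R.1#) (p · R.1#))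
        (R.trans (R.sym (MultR.×-homo-+ R.1# p d)) (R.trans (R.sym eq) (R.sym (R.+-identityˡ (p · R.1#))))))))) (ℕ.+-identityʳ p))

    ·1-injective : ∀ {p q} → p · R.1# R.≈ q · R.1# → p ≡ q
    ·1-injective {p} {q} eq with ℕ.≤-total p q
    ... | inj₁ p≤q = ·1-injective-≤ p≤q eq
    ... | inj₂ q≤p = sym (·1-injective-≤ q≤p (R.sym eq))

    image-injective : ∀ {z w x y} → Image z x → Image w y → x R.≈ y → z ≡ w
    image-injective {z} {w} (image a b p q) (image a′ b′ p′ q′) x≈y =
      +-cancelˡ ((a ℕ.+ b′) ℤᵈ.· 1ℤ) (trans (ℤ.+-comm ((a ℕ.+ b′) ℤᵈ.· 1ℤ) z)
        (trans (cong (λ k → z + k ℤᵈ.· 1ℤ) equal) (trans (ℤᵈ.rep-sum p p′) (ℤ.+-comm w ((a ℕ.+ b′) ℤᵈ.· 1ℤ)))))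
      where
      equal : a ℕ.+ b′ ≡ a′ ℕ.+ b
      equal = ·1-injective (+-cancelˡᴿ (R.trans (R.+-congʳ x≈y) (R.sym (Rᵈ.rep-sum q q′))))
        where
        +-cancelˡᴿ : ∀ {x y z} → x R.+ y R.≈ x R.+ z → y R.≈ z
        +-cancelˡᴿ {x} {y} {z} = RingProperties.+-cancelˡ R.ring x y z

-- From the D-spectrum to the traces of powers

shifted : ∀ {n} → ConnectedGraph n → Matrix n
shifted G i j = identity i j + + distance G i j

module _ {c ℓ₁ ℓ₂} (K : HeytingField c ℓ₁ ℓ₂) (char-zero : CharacteristicZero K) where
  private
    module K = HeytingField K
    R : CommutativeRing c ℓ₁
    R = HeytingCommutativeRing.commutativeRing K.heytingCommutativeRing
    module R = CommutativeRing R
    module ↭ = PermutationProperties R.setoid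
    open Determinant R using (_·_; characteristic) renaming (identity to identityᴷ; det to detᴷ; _^_ to _^ᴷ_)
    open DeterminantProperties R
    open RingProperties R.ring using (-‿distribˡ-*; -‿distribʳ-*; -0#≈0#)
    open SetoidReasoning R.setoid renaming (begin_ to begin≈_; _∎ to _∎≈)

    _↭_ : List K.Carrier → List K.Carrier → Set (c Level.⊔ ℓ₁)
    _↭_ = Permutation.Permutation K._≈_

  roots-product-↭ : ∀ x {λs μs} → λs ↭ μs →
    foldr K._*_ K.1# (map (λ y → x K.- y) λs) K.≈ foldr K._*_ K.1# (map (λ y → x K.- y) μs)
  roots-product-↭ x λs↭μs = ↭.foldr-commMonoid R.*-isCommutativeMonoid
    (↭.map⁺ R.setoid (λ y≈z → R.+-congˡ (R.-‿cong y≈z)) λs↭μs)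

  module _ {m n} (H : ConnectedGraph m) (G : ConnectedGraph n) where

    cospectral-order : DCospectral K H G → m ≡ n
    cospectral-order (λs , μs , (|λs| , _) , (|μs| , _) , λs↭μs) =
      trans (sym |λs|) (trans (↭.xs↭ys⇒|xs|≡|ys| λs↭μs) |μs|)

    cospectral-characteristic : DCospectral K H G → ∀ x → characteristic (D K H) x K.≈ characteristic (D K G) x
    cospectral-characteristic (λs , μs , (_ , H-roots) , (_ , G-roots) , λs↭μs) x =
      R.trans (H-roots x) (R.trans (roots-product-↭ x λs↭μs) (R.sym (G-roots x)))

  -- I - u (D + I) = u ((1/u - 1) I - D).
  reversedᴷ : ∀ {n} → ConnectedGraph n → K.Carrier → K.Carrier
  reversedᴷ G u = detᴷ λ i j → identityᴷ i j K.+ (K.- u) K.* (identityᴷ i j K.+ D K G i j)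

  reversedᴷ-characteristic : ∀ {n} (G : ConnectedGraph n) u z → u K.* z K.≈ K.1# →
    reversedᴷ G u K.≈ (u ^ᴷ n) K.* characteristic (D K G) (z K.- K.1#)
  reversedᴷ-characteristic {n} G u z uz≈1 = R.trans
    (det-cong≈ λ i j → entry (identityᴷ i j) (D K G i j))
    (det-scale u λ i j → (z K.- K.1#) K.* identityᴷ i j K.- D K G i j)
    where
    entry : ∀ δ d → δ K.+ (K.- u) K.* (δ K.+ d) K.≈ u K.* ((z K.- K.1#) K.* δ K.- d)
    entry δ d = R.sym (begin≈
      u K.* ((z K.- K.1#) K.* δ K.- d)
        ≈⟨ R.distribˡ u ((z K.- K.1#) K.* δ) (K.- d) ⟩
      u K.* ((z K.- K.1#) K.* δ) K.+ u K.* (K.- d)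
        ≈⟨ R.+-cong (R.sym (R.*-assoc u (z K.- K.1#) δ)) (R.trans (R.sym (-‿distribʳ-* u d)) (-‿distribˡ-* u d)) ⟩
      u K.* (z K.- K.1#) K.* δ K.+ (K.- u) K.* d
        ≈⟨ R.+-congʳ (R.*-congʳ (R.trans (R.distribˡ u z (K.- K.1#)) (R.+-cong uz≈1
             (R.trans (R.trans (R.sym (-‿distribʳ-* u K.1#)) (-‿distribˡ-* u K.1#)) (R.*-identityʳ (K.- u)))))) ⟩
      (K.1# K.+ (K.- u)) K.* δ K.+ (K.- u) K.* d
        ≈⟨ R.+-congʳ (R.trans (R.distribʳ δ K.1# (K.- u)) (R.+-congʳ (R.*-identityˡ δ))) ⟩
      (δ K.+ (K.- u) K.* δ) K.+ (K.- u) K.* d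
        ≈⟨ R.+-assoc δ ((K.- u) K.* δ) ((K.- u) K.* d) ⟩
      δ K.+ ((K.- u) K.* δ K.+ (K.- u) K.* d)
        ≈⟨ R.+-congˡ (R.distribˡ (K.- u) δ d) ⟨
      δ K.+ (K.- u) K.* (δ K.+ d) ∎≈)

  image-reversed : ∀ {n} (G : ConnectedGraph n) {y u} → Image R y u → Image R (reversed (shifted G) y) (reversedᴷ G u)
  image-reversed G {y} {u} i = subst (λ z → Image R z (reversedᴷ G u)) (sym (Det≡det (I- y · shifted G)))
    (image-det R λ j k → image-+ R (image-identity R j k)
      (image-* R (image-neg R i) (image-+ R (image-identity R j k) (image-nat R (distance G j k)))))

  -- The characteristic polynomial is evaluated at 1/u - 1, so y = 0 is treated apart. For y ≠ 0 the
  -- image `u` is only known to differ from 0, which in a Heyting field yields no inverse directly.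
  -- Tightness does refute that `u` is not apart from 0, and this suffices because equality of
  -- integers is decidable.
  cospectral-reversed : ∀ {n} (H G : ConnectedGraph n) → DCospectral K H G →
    ∀ y → reversed (shifted H) y ≡ reversed (shifted G) y
  cospectral-reversed {n} H G cospectral y with y ℤ.≟ 0ℤ
  ... | yes refl = trans (at-zero H) (sym (at-zero G))
    where
    at-zero : ∀ (G : ConnectedGraph n) → reversed (shifted G) 0ℤ ≡ 1ℤ
    at-zero G = let (r , eq) = reversed-one (shifted G) 0ℤ in trans eq (cong (_+_ 1ℤ) (ℤ.*-zeroˡ r))
  ... | no y≢0 = decidable-stable (_ ℤ.≟ _) λ differ →
    let (u , i) = image-any R y
        u≉0 : ¬ (u K.≈ K.0#)
        u≉0 u≈0 = y≢0 (image-injective R char-zero i (image-0 R) u≈0)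
        ¬u#0 : ¬ (u K.# K.0#)
        ¬u#0 u#0 =
          let (z , _ , right) = K.#⇒invertible u#0
              uz≈1 = R.trans (R.*-congʳ (R.sym (R.trans (R.+-congˡ -0#≈0#) (R.+-identityʳ u)))) right
          in differ (image-injective R char-zero (image-reversed H i) (image-reversed G i)
               (R.trans (reversedᴷ-characteristic H u z uz≈1)
                 (R.trans (R.*-congˡ (cospectral-characteristic H G cospectral (z K.- K.1#)))
                   (R.sym (reversedᴷ-characteristic G u z uz≈1)))))
    in u≉0 (proj₁ (K.tight u K.0#) ¬u#0)

  cospectral-traces : ∀ {n} (H G : ConnectedGraph n) → DCospectral K H G → SameTraces (shifted H) (shifted G)
  cospectral-traces H G cospectral =
    reversed-determines-traces (shifted H) (shifted G) (cospectral-reversed H G cospectral)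

-- Distances

module _ where
  private variable
    P : ℕ → Set

  least-satisfies : (P? : ∀ k → Dec (P k)) → ∀ n (p : P n) → P (least P? n p)
  least-satisfies P? zero    p = p
  least-satisfies P? (suc n) p with P? 0
  ... | yes p₀ = p₀
  ... | no  _  = least-satisfies (P? ∘ suc) n p

  least-minimal : (P? : ∀ k → Dec (P k)) → ∀ n (p : P n) {k} → P k → least P? n p ≤ k
  least-minimal P? zero    p       q = z≤n
  least-minimal P? (suc n) p {k}   q with P? 0
  least-minimal P? (suc n) p {k}   q | yes _ = z≤n
  least-minimal P? (suc n) p {zero}  q | no ¬p₀ = contradiction q ¬p₀
  least-minimal P? (suc n) p {suc k} q | no _   = s≤s (least-minimal (P? ∘ suc) n p q)

module Distance {n} (G : ConnectedGraph n) where
  open ConnectedGraph G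

  d : Fin n → Fin n → ℕ
  d = distance G

  walk-++ : ∀ k {l u v w} → Walk _∼_ k u v → Walk _∼_ l v w → Walk _∼_ (k ℕ.+ l) u w
  walk-++ zero    refl        q = q
  walk-++ (suc k) (x , e , p) q = x , e , walk-++ k p q

  walk-reverse : ∀ k {u v} → Walk _∼_ k u v → Walk _∼_ k v u
  walk-reverse zero    refl = refl
  walk-reverse (suc k) {u} {v} (x , e , p) =
    subst (λ l → Walk _∼_ l v u) (ℕ.+-comm k 1) (walk-++ k (walk-reverse k p) (u , ∼-sym e , refl))

  distance-walk : ∀ u v → Walk _∼_ (d u v) u v
  distance-walk u v = let (k , p) = connected u v in least-satisfies (λ j → walk? j u v) k p

  distance-≤ : ∀ {k u v} → Walk _∼_ k u v → d u v ≤ k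
  distance-≤ {k} {u} {v} q = let (l , p) = connected u v in least-minimal (λ j → walk? j u v) l p q

  distance-self : ∀ u → d u u ≡ 0
  distance-self u = ℕ.n≤0⇒n≡0 (distance-≤ {0} refl)

  distance-zero : ∀ {u v} → d u v ≡ 0 → u ≡ v
  distance-zero {u} {v} eq = subst (λ k → Walk _∼_ k u v) eq (distance-walk u v)

  distance-sym : ∀ u v → d u v ≡ d v u
  distance-sym u v = ℕ.≤-antisym
    (distance-≤ (walk-reverse (d v u) (distance-walk v u)))
    (distance-≤ (walk-reverse (d u v) (distance-walk u v)))

  triangle : ∀ u v w → d u w ≤ d u v ℕ.+ d v w
  triangle u v w = distance-≤ (walk-++ (d u v) (distance-walk u v) (distance-walk v w))

  distance-positive : ∀ {u v k} → d u v ≡ suc k → u ≢ v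
  distance-positive {u} eq refl with () ← trans (sym (distance-self u)) eq

  adjacent⇒distance : ∀ {u v} → u ∼ v → d u v ≡ 1
  adjacent⇒distance {u} {v} e with d u v in eq | distance-≤ {1} (v , e , refl)
  ... | 0 | _ = contradiction (subst (u ∼_) (sym (distance-zero eq)) e) ∼-irrefl
  ... | 1 | _ = refl
  ... | suc (suc _) | s≤s ()

  distance⇒adjacent : ∀ {u v} → d u v ≡ 1 → u ∼ v
  distance⇒adjacent {u} {v} eq with subst (λ k → Walk _∼_ k u v) eq (distance-walk u v)
  ... | _ , e , refl = e

  -- Removes the first edge of a shortest walk; by the triangle inequality a shorter way from `w`
  -- would shorten the whole walk.
  towards : ∀ {u v k} → d u v ≡ suc k → ∃[ w ] d u w ≡ 1 × d w v ≡ k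
  towards {u} {v} {k} eq with subst (λ k → Walk _∼_ k u v) eq (distance-walk u v)
  ... | w , e , p = w , adjacent⇒distance e , ℕ.≤-antisym (distance-≤ p)
    (ℕ.s≤s⁻¹ (subst₂ _≤_ eq (cong (ℕ._+ d w v) (adjacent⇒distance e)) (triangle u w v)))

  shifted-off : ∀ {u v} → u ≢ v → shifted G u v ≡ + d u v
  shifted-off {u} {v} u≢v = cong (_+ + d u v) (identity-off u≢v)

  shifted-diag : ∀ u → shifted G u u ≡ + 1
  shifted-diag u = cong₂ (λ x k → x + + k) (identity-diag u) (distance-self u)

  shifted-entry : ∀ {u v k} → d u v ≡ suc k → shifted G u v ≡ + suc k
  shifted-entry eq = trans (shifted-off (distance-positive eq)) (cong +_ eq)

  shifted-sym : ∀ u v → shifted G u v ≡ shifted G v u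
  shifted-sym u v = by-cases (u ≟ᶠ v)
    where
    by-cases : Dec (u ≡ v) → shifted G u v ≡ shifted G v u
    by-cases (yes refl) = refl
    by-cases (no u≢v)   = trans (shifted-off u≢v)
      (trans (cong +_ (distance-sym u v)) (sym (shifted-off (u≢v ∘ sym))))

-- Graphs whose shifted distance matrix has rank at most 3

-- K^{s,t} consists of the vertices of K_s alone (label 0), of K_t alone (label 1), and the
-- common vertex (label 2).
pattern 0ᶠ = zero
pattern 1ᶠ = suc zero
pattern 2ᶠ = suc (suc zero)
pattern 3ᶠ = suc (suc (suc zero))

block : Fin 3 → Fin 3 → ℤ
block 0ᶠ 1ᶠ = + 2
block 1ᶠ 0ᶠ = + 2
block _  _  = + 1

Labelling : ∀ {n} → ConnectedGraph n → (Fin n → Fin 3) → Set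
Labelling G ℓ = ∀ u v → shifted G u v ≡ block (ℓ u) (ℓ v)

table : ℤ → ℤ → ℤ → ℤ → ℤ → ℤ → Matrix 4
table x₀₁ x₀₂ x₀₃ x₁₂ x₁₃ x₂₃ = λ where
  0ᶠ → (+ 1 ∷ x₀₁ ∷ x₀₂ ∷ x₀₃ ∷ [])
  1ᶠ → (x₀₁ ∷ + 1 ∷ x₁₂ ∷ x₁₃ ∷ [])
  2ᶠ → (x₀₂ ∷ x₁₂ ∷ + 1 ∷ x₂₃ ∷ [])
  3ᶠ → (x₀₃ ∷ x₁₃ ∷ x₂₃ ∷ + 1 ∷ [])

RankAtMost3 : ∀ {n} → Matrix n → Set
RankAtMost3 {n} M = ∀ (I J : Fin 4 → Fin n) → Det (λ r c → M (I r) (J c)) ≡ 0ℤ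

labelling-rank : ∀ {n} (G : ConnectedGraph n) {ℓ} → Labelling G ℓ → RankAtMost3 (shifted G)
labelling-rank G {ℓ} lab I J with pigeonhole (s≤s (s≤s (s≤s (s≤s z≤n)))) (ℓ ∘ I)
... | i , j , i<j , ℓi≡ℓj = det-repeated _ (λ i≡j → Fin.<⇒≢ i<j i≡j) λ c →
  trans (lab (I i) (J c)) (trans (cong (λ l → block l (ℓ (J c))) ℓi≡ℓj) (sym (lab (I j) (J c))))

module Structure {n} (G : ConnectedGraph n) (rank : RankAtMost3 (shifted G)) where
  open Distance G

  -- Leads from the opaque `Det` to `det`, which computes on tables of literals, so that an absurd
  -- pattern can refute its vanishing. Distances written as successors make the vertices distinct,
  -- as `shifted-entry` requires.
  principal-minor : ∀ {a b c e x₀₁ x₀₂ x₀₃ x₁₂ x₁₃ x₂₃} →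
    d a b ≡ suc x₀₁ → d a c ≡ suc x₀₂ → d a e ≡ suc x₀₃ → d b c ≡ suc x₁₂ → d b e ≡ suc x₁₃ → d c e ≡ suc x₂₃ →
    det (table (+ suc x₀₁) (+ suc x₀₂) (+ suc x₀₃) (+ suc x₁₂) (+ suc x₁₃) (+ suc x₂₃)) ≡ 0ℤ
  principal-minor {a} {b} {c} {e} ab ac ae bc be ce = trans (sym (Det≡det _))
    (trans (sym (det-cong entries)) (rank vertices vertices))
    where
    vertices : Fin 4 → Fin n
    vertices = a ∷ b ∷ c ∷ e ∷ []
    flip : ∀ {u v k} → d u v ≡ suc k → d v u ≡ suc k
    flip {u} {v} eq = trans (distance-sym v u) eq
    entries : (λ r c → shifted G (vertices r) (vertices c)) ≐ table _ _ _ _ _ _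
    entries 0ᶠ 0ᶠ = shifted-diag a
    entries 0ᶠ 1ᶠ = shifted-entry ab
    entries 0ᶠ 2ᶠ = shifted-entry ac
    entries 0ᶠ 3ᶠ = shifted-entry ae
    entries 1ᶠ 0ᶠ = shifted-entry (flip ab)
    entries 1ᶠ 1ᶠ = shifted-diag b
    entries 1ᶠ 2ᶠ = shifted-entry bc
    entries 1ᶠ 3ᶠ = shifted-entry be
    entries 2ᶠ 0ᶠ = shifted-entry (flip ac)
    entries 2ᶠ 1ᶠ = shifted-entry (flip bc)
    entries 2ᶠ 2ᶠ = shifted-diag c
    entries 2ᶠ 3ᶠ = shifted-entry ce
    entries 3ᶠ 0ᶠ = shifted-entry (flip ae)
    entries 3ᶠ 1ᶠ = shifted-entry (flip be)
    entries 3ᶠ 2ᶠ = shifted-entry (flip ce)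
    entries 3ᶠ 3ᶠ = shifted-diag e

  -- An isometric path on four vertices has a nonsingular matrix.
  no-distance-3 : ∀ {u v} → d u v ≢ 3
  no-distance-3 {u} {v} uv =
    let (w , uw , wv) = towards uv
        (x , wx , xv) = towards wv
        ux : d u x ≡ 2
        ux = ℕ.≤-antisym (subst₂ (λ i j → d u x ≤ i ℕ.+ j) uw wx (triangle u w x))
          (ℕ.s≤s⁻¹ (subst₂ _≤_ uv (trans (cong (d u x ℕ.+_) xv) (ℕ.+-comm (d u x) 1)) (triangle u x v)))
    in nonsingular (principal-minor uw ux uv wx wv xv)
    where
    nonsingular : det (table (+ 1) (+ 2) (+ 3) (+ 1) (+ 2) (+ 1)) ≢ 0ℤ
    nonsingular ()

  -- A longer shortest walk ends in one of length 3, reached by dropping first edges.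
  diameter-2 : ∀ k {u v} → d u v ≢ suc (suc (suc k))
  diameter-2 zero    eq = no-distance-3 eq
  diameter-2 (suc k) eq = let (_ , _ , eq′) = towards eq in diameter-2 k eq′

  infix 4 _⟂_ _⟂?_
  _⟂_ : Fin n → Fin n → Set
  u ⟂ v = d u v ≡ 2

  _⟂?_ : ∀ u v → Dec (u ⟂ v)
  u ⟂? v = d u v ℕ.≟ 2

  ⟂-sym : ∀ {u v} → u ⟂ v → v ⟂ u
  ⟂-sym {u} {v} eq = trans (distance-sym v u) eq

  distance-1 : ∀ {u v} → u ≢ v → ¬ u ⟂ v → d u v ≡ 1
  distance-1 {u} {v} u≢v ¬⟂ with d u v in eq
  ... | 0 = contradiction (distance-zero eq) u≢v
  ... | 1 = refl
  ... | 2 = contradiction refl ¬⟂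
  ... | suc (suc (suc k)) = contradiction eq (diameter-2 k)

  -- In the graph of ⟂ the matrices of the following induced subgraphs are nonsingular.
  no-triangle-with-isolated : ∀ {a b c e} → a ⟂ b → a ⟂ c → b ⟂ c → d a e ≡ 1 → d b e ≡ 1 → d c e ≢ 1
  no-triangle-with-isolated ab ac bc ae be ce = nonsingular (principal-minor ab ac ae bc be ce)
    where
    nonsingular : det (table (+ 2) (+ 2) (+ 1) (+ 2) (+ 1) (+ 1)) ≢ 0ℤ
    nonsingular ()

  no-paw : ∀ {a b c e} → a ⟂ b → a ⟂ c → b ⟂ c → a ⟂ e → d b e ≡ 1 → d c e ≢ 1
  no-paw ab ac bc ae be ce = nonsingular (principal-minor ab ac ae bc be ce)
    where
    nonsingular : det (table (+ 2) (+ 2) (+ 2) (+ 2) (+ 1) (+ 1)) ≢ 0ℤ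
    nonsingular ()

  no-matching : ∀ {a b c e} → a ⟂ b → d a c ≡ 1 → d a e ≡ 1 → d b c ≡ 1 → d b e ≡ 1 → ¬ c ⟂ e
  no-matching ab ac ae bc be ce = nonsingular (principal-minor ab ac ae bc be ce)
    where
    nonsingular : det (table (+ 2) (+ 1) (+ 1) (+ 1) (+ 1) (+ 2)) ≢ 0ℤ
    nonsingular ()

  no-path : ∀ {a b c e} → a ⟂ b → d a c ≡ 1 → d a e ≡ 1 → b ⟂ c → d b e ≡ 1 → ¬ c ⟂ e
  no-path ab ac ae bc be ce = nonsingular (principal-minor ab ac ae bc be ce)
    where
    nonsingular : det (table (+ 2) (+ 1) (+ 1) (+ 2) (+ 1) (+ 2)) ≢ 0ℤ
    nonsingular ()

  -- Take a common neighbour `w` of `p` and `q` in the graph. If `r ⟂ w`, the four vertices form a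
  -- paw with `w` pendant at `r`; otherwise `w` is isolated from the triangle.
  no-triangle : ∀ {p q r} → p ⟂ q → p ⟂ r → ¬ q ⟂ r
  no-triangle {p} {q} {r} pq pr qr with (w , pw , wq) ← towards pq | r ⟂? w
  ... | yes rw = no-paw (⟂-sym pr) (⟂-sym qr) pq rw pw (trans (distance-sym q w) wq)
  ... | no ¬rw = no-triangle-with-isolated pq pr qr pw (trans (distance-sym q w) wq)
    (distance-1 (λ { refl → contradiction (trans (sym pw) pr) λ () }) ¬rw)

  module _ {p q} (pq : p ⟂ q) where

    -- Otherwise u, q, p, v would be an induced path of `⟂`: further edges among them would close a
    -- triangle.
    ⟂-join : ∀ {u v} → u ⟂ q → v ⟂ p → u ⟂ v
    ⟂-join {u} {v} uq vp with u ⟂? v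
    ... | yes uv = uv
    ... | no ¬uv = contradiction (⟂-sym vp)
      (no-path uq (distance-1 u≢p ¬up) (distance-1 u≢v ¬uv) (⟂-sym pq) (distance-1 q≢v ¬qv))
      where
      ¬up : ¬ u ⟂ p
      ¬up up = no-triangle up uq pq
      ¬qv : ¬ q ⟂ v
      ¬qv qv = no-triangle pq (⟂-sym vp) qv
      u≢p : u ≢ p
      u≢p refl = ¬uv (⟂-sym vp)
      q≢v : q ≢ v
      q≢v refl = ¬uv uq
      u≢v : u ≢ v
      u≢v refl = ¬up vp

    -- Otherwise v, u, q, p would be an induced path of `⟂`.
    ⟂-isolated-from : ∀ {u v} → ¬ v ⟂ p → ¬ v ⟂ q → u ⟂ q → ¬ v ⟂ u
    ⟂-isolated-from {u} {v} ¬vp ¬vq uq vu =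
      no-path vu (distance-1 v≢q ¬vq) (distance-1 v≢p ¬vp) uq (distance-1 u≢p λ up → no-triangle up uq pq) (⟂-sym pq)
      where
      v≢q : v ≢ q
      v≢q refl = ¬vp (⟂-sym pq)
      v≢p : v ≢ p
      v≢p refl = ¬vq pq
      u≢p : u ≢ p
      u≢p refl = ¬vp vu

  module _ {p q} (pq : p ⟂ q) where

    -- If `u` is joined to `p` or `q`, an induced path arises; if to neither, the edges `v ⟂ u` and
    -- `p ⟂ q` form an induced matching.
    ⟂-isolated : ∀ {u v} → ¬ v ⟂ p → ¬ v ⟂ q → ¬ v ⟂ u
    ⟂-isolated {u} {v} ¬vp ¬vq vu with u ⟂? q | u ⟂? p
    ... | yes uq | _      = ⟂-isolated-from pq ¬vp ¬vq uq vu
    ... | no _   | yes up = ⟂-isolated-from (⟂-sym pq) ¬vq ¬vp up vu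
    ... | no ¬uq | no ¬up = no-matching vu (distance-1 v≢p ¬vp) (distance-1 v≢q ¬vq)
      (distance-1 u≢p ¬up) (distance-1 u≢q ¬uq) pq
      where
      v≢p : v ≢ p
      v≢p refl = ¬vq pq
      v≢q : v ≢ q
      v≢q refl = ¬vp (⟂-sym pq)
      u≢p : u ≢ p
      u≢p refl = ¬uq pq
      u≢q : u ≢ q
      u≢q refl = ¬up (⟂-sym pq)

    -- The two sides are the `⟂`-neighbourhoods of `q` and of `p`, so `p` itself gets label 0 and
    -- `q` gets label 1.
    label : Fin n → Fin 3
    label v with v ⟂? q | v ⟂? p
    ... | yes _ | _     = 0ᶠ
    ... | no  _ | yes _ = 1ᶠ
    ... | no  _ | no  _ = 2ᶠ

    two : ∀ {u v} → u ⟂ v → shifted G u v ≡ + 2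
    two = shifted-entry

    one : ∀ {u v} → ¬ u ⟂ v → shifted G u v ≡ + 1
    one {u} {v} ¬⟂ = by-cases (u ≟ᶠ v)
      where
      by-cases : Dec (u ≡ v) → shifted G u v ≡ + 1
      by-cases (yes refl) = shifted-diag u
      by-cases (no u≢v)   = shifted-entry (distance-1 u≢v ¬⟂)

    label-labelling : Labelling G label
    label-labelling u v with u ⟂? q | u ⟂? p | v ⟂? q | v ⟂? p
    ... | yes uq | _      | yes vq | _      = one λ uv → no-triangle uv uq vq
    ... | yes uq | _      | no _   | yes vp = two (⟂-join pq uq vp)
    ... | yes uq | _      | no ¬vq | no ¬vp = one {u} {v} λ uv → ⟂-isolated ¬vp ¬vq (⟂-sym uv)
    ... | no _   | yes up | yes vq | _      = two (⟂-sym (⟂-join pq vq up))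
    ... | no _   | yes up | no _   | yes vp = one λ uv → no-triangle uv up vp
    ... | no _   | yes up | no ¬vq | no ¬vp = one {u} {v} λ uv → ⟂-isolated ¬vp ¬vq (⟂-sym uv)
    ... | no ¬uq | no ¬up | yes _  | _      = one (⟂-isolated ¬up ¬uq)
    ... | no ¬uq | no ¬up | no _   | yes _  = one (⟂-isolated ¬up ¬uq)
    ... | no ¬uq | no ¬up | no _   | no _   = one (⟂-isolated ¬up ¬uq)

  labelling : ∃[ ℓ ] Labelling G ℓ
  labelling with Fin.any? (λ p → Fin.any? (p ⟂?_))
  ... | yes (p , q , pq) = label pq , label-labelling pq
  -- Here the graph is complete and the shifted matrix has all entries 1.
  ... | no none = (λ _ → 2ᶠ) , λ u v → by-cases u v (u ≟ᶠ v)
    where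
    by-cases : ∀ u v → Dec (u ≡ v) → shifted G u v ≡ + 1
    by-cases u v (yes refl) = shifted-diag u
    by-cases u v (no u≢v)   = shifted-entry (distance-1 u≢v λ uv → none (u , v , uv))

-- Counting labels

δ : Fin 3 → Fin 3 → ℕ
δ c e = if does (c ≟ᶠ e) then 1 else 0

count : ∀ {n} → (Fin n → Fin 3) → Fin 3 → ℕ
count {zero}  ℓ c = 0
count {suc n} ℓ c = δ (ℓ zero) c ℕ.+ count (ℓ ∘ suc) c

count-remove : ∀ {n} (ℓ : Fin (suc n) → Fin 3) j c → count ℓ c ≡ δ (ℓ j) c ℕ.+ count (ℓ ∘ punchIn j) c
count-remove         ℓ zero    c = refl
count-remove {suc n} ℓ (suc j) c = trans
  (cong (δ (ℓ zero) c ℕ.+_) (count-remove (ℓ ∘ suc) j c))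
  (x∙yz≈y∙xz (δ (ℓ zero) c) (δ (ℓ (suc j)) c) (count (ℓ ∘ suc ∘ punchIn j) c))
  where open CommutativeSemigroupProperties ℕ.+-commutativeSemigroup using (x∙yz≈y∙xz)

δ-refl : ∀ c → δ c c ≡ 1
δ-refl 0ᶠ = refl
δ-refl 1ᶠ = refl
δ-refl 2ᶠ = refl

count-positive : ∀ {n} (ℓ : Fin n → Fin 3) {j c} → ℓ j ≡ c → count ℓ c ≢ 0
count-positive {suc n} ℓ {j} refl eq
  with () ← trans (sym (δ-refl (ℓ j))) (ℕ.m+n≡0⇒m≡0 (δ (ℓ j) (ℓ j)) (trans (sym (count-remove ℓ j (ℓ j))) eq))

count-witness : ∀ {n} (ℓ : Fin n → Fin 3) c → count ℓ c ≢ 0 → ∃[ j ] ℓ j ≡ c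
count-witness {zero}  ℓ c ≢0 = contradiction refl ≢0
count-witness {suc n} ℓ c ≢0 with ℓ zero ≟ᶠ c
... | yes eq = zero , eq
... | no  _  = let (j , eq) = count-witness (ℓ ∘ suc) c ≢0 in suc j , eq

-- Built greedily: vertex zero goes to some `j` with the same label, and the counts still agree once
-- both are removed.
matching : ∀ {n} (ℓ ℓ′ : Fin n → Fin 3) → (∀ c → count ℓ c ≡ count ℓ′ c) →
  ∃[ π ] ∀ i → ℓ′ (π Perm.⟨$⟩ʳ i) ≡ ℓ i
matching {zero}  ℓ ℓ′ same = Perm.id , λ ()
matching {suc n} ℓ ℓ′ same = Perm.insert zero j π , λ where
    zero    → trans (cong ℓ′ (insert-head j π)) ℓ′j
    (suc i) → trans (cong ℓ′ (Perm.insert-punchIn zero j π i)) (π-labels i)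
  where
  witness = count-witness ℓ′ (ℓ zero) (count-positive ℓ {zero} refl ∘ trans (same (ℓ zero)))
  j = proj₁ witness
  ℓ′j = proj₂ witness
  rest = matching (ℓ ∘ suc) (ℓ′ ∘ punchIn j) λ c → ℕ.+-cancelˡ-≡ (δ (ℓ zero) c) _ _
    (trans (same c) (trans (count-remove ℓ′ j c) (cong (λ l → δ l c ℕ.+ count (ℓ′ ∘ punchIn j) c) ℓ′j)))
  π = proj₁ rest
  π-labels = proj₂ rest
  insert-head : ∀ j (π : Perm.Permutation n n) → Perm.insert zero j π Perm.⟨$⟩ʳ zero ≡ j
  insert-head j π = refl

-- Traces of powers as polynomials in the label counts

module _ {n} (ℓ : Fin n → Fin 3) where

  a₀ a₁ a₂ : ℤ
  a₀ = + count ℓ 0ᶠ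
  a₁ = + count ℓ 1ᶠ
  a₂ = + count ℓ 2ᶠ

weighted-count : ∀ {n} (ℓ : Fin n → Fin 3) (f : Fin 3 → ℤ) →
  ∑ (λ i → f (ℓ i)) ≡ a₀ ℓ * f 0ᶠ + a₁ ℓ * f 1ᶠ + a₂ ℓ * f 2ᶠ
weighted-count {zero}  ℓ f = trans ∑-nil (zeros (f 0ᶠ) (f 1ᶠ) (f 2ᶠ))
  where
  zeros : ∀ x y z → 0ℤ ≡ 0ℤ * x + 0ℤ * y + 0ℤ * z
  zeros = solve-∀
weighted-count {suc n} ℓ f = trans ∑-suc (trans (cong (_+_ (f (ℓ zero))) (weighted-count (ℓ ∘ suc) f)) (add (ℓ zero)))
  where
  x = a₀ (ℓ ∘ suc)
  y = a₁ (ℓ ∘ suc)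
  z = a₂ (ℓ ∘ suc)
  add₀ : ∀ u v w x y z → u + (x * u + y * v + z * w) ≡ (1ℤ + x) * u + (0ℤ + y) * v + (0ℤ + z) * w
  add₀ = solve-∀
  add₁ : ∀ u v w x y z → v + (x * u + y * v + z * w) ≡ (0ℤ + x) * u + (1ℤ + y) * v + (0ℤ + z) * w
  add₁ = solve-∀
  add₂ : ∀ u v w x y z → w + (x * u + y * v + z * w) ≡ (0ℤ + x) * u + (0ℤ + y) * v + (1ℤ + z) * w
  add₂ = solve-∀
  add : ∀ c → f c + (x * f 0ᶠ + y * f 1ᶠ + z * f 2ᶠ) ≡
    (+ δ c 0ᶠ + x) * f 0ᶠ + (+ δ c 1ᶠ + y) * f 1ᶠ + (+ δ c 2ᶠ + z) * f 2ᶠ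
  add 0ᶠ = add₀ (f 0ᶠ) (f 1ᶠ) (f 2ᶠ) x y z
  add 1ᶠ = add₁ (f 0ᶠ) (f 1ᶠ) (f 2ᶠ) x y z
  add 2ᶠ = add₂ (f 0ᶠ) (f 1ᶠ) (f 2ᶠ) x y z

order : ∀ {n} (ℓ : Fin n → Fin 3) → + n ≡ a₀ ℓ + a₁ ℓ + a₂ ℓ
order {n} ℓ = trans (sym (trans (∑-const n 1ℤ) (ℤ.*-identityʳ (+ n))))
  (trans (weighted-count ℓ λ _ → 1ℤ) (units (a₀ ℓ) (a₁ ℓ) (a₂ ℓ)))
  where
  units : ∀ x y z → x * 1ℤ + y * 1ℤ + z * 1ℤ ≡ x + y + z
  units = solve-∀

module _ {n} (G : ConnectedGraph n) {ℓ} (lab : Labelling G ℓ) where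

  private
    M = shifted G
    p = a₀ ℓ
    q = a₁ ℓ
    r = a₂ ℓ
    block² : Fin 3 → Fin 3 → ℤ
    block² c e = p * (block c 0ᶠ * block 0ᶠ e) + q * (block c 1ᶠ * block 1ᶠ e) + r * (block c 2ᶠ * block 2ᶠ e)

    square-entry : ∀ i j → power⁺ M 1 i j ≡ block² (ℓ i) (ℓ j)
    square-entry i j = trans
      (∑-cong λ a → cong₂ _*_ (lab i a) (lab a j))
      (weighted-count ℓ λ e → block (ℓ i) e * block e (ℓ j))

    block³ : Fin 3 → ℤ
    block³ c = p * (block² c 0ᶠ * block 0ᶠ c) + q * (block² c 1ᶠ * block 1ᶠ c) + r * (block² c 2ᶠ * block 2ᶠ c)

  -- Write M = J + B, with J the all-ones matrix and B the adjacency matrix of the complete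
  -- bipartite graph between labels 0 and 1. Then tr J² = n², and tr JB = tr B² = 2pq.
  trace-2 : tr (power⁺ (shifted G) 1) ≡ (p + q + r) * (p + q + r) + + 6 * (p * q)
  trace-2 = trans
    (trans (∑-cong λ i → square-entry i i) (weighted-count ℓ λ c → block² c c))
    (evaluate p q r)
    where
    evaluate : ∀ p q r →
      p * (p * (+ 1 * + 1) + q * (+ 2 * + 2) + r * (+ 1 * + 1)) +
      q * (p * (+ 2 * + 2) + q * (+ 1 * + 1) + r * (+ 1 * + 1)) +
      r * (p * (+ 1 * + 1) + q * (+ 1 * + 1) + r * (+ 1 * + 1)) ≡
      (p + q + r) * (p + q + r) + + 6 * (p * q)
    evaluate = solve-∀

  -- For M = J + B as before, tr J²B = 2npq, tr JB² = pq(p + q) is the sum of squared degrees, and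
  -- tr B³ = 0 by bipartiteness. Substituting p + q = n - r gives the coefficients 9 and -3.
  trace-3 : tr (power⁺ (shifted G) 2) ≡
    (p + q + r) * (p + q + r) * (p + q + r) + + 9 * (p + q + r) * (p * q) + -[1+ 2 ] * (p * q) * r
  trace-3 = trans
    (trans (∑-cong λ i → trans
        (∑-cong λ a → cong₂ _*_ (square-entry i a) (lab a i))
        (weighted-count ℓ λ e → block² (ℓ i) e * block e (ℓ i)))
      (weighted-count ℓ block³))
    (evaluate p q r)
    where
    evaluate : ∀ p q r →
      p * (p * ((p * (+ 1 * + 1) + q * (+ 2 * + 2) + r * (+ 1 * + 1)) * + 1) +
           q * ((p * (+ 1 * + 2) + q * (+ 2 * + 1) + r * (+ 1 * + 1)) * + 2) +
           r * ((p * (+ 1 * + 1) + q * (+ 2 * + 1) + r * (+ 1 * + 1)) * + 1)) +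
      q * (p * ((p * (+ 2 * + 1) + q * (+ 1 * + 2) + r * (+ 1 * + 1)) * + 2) +
           q * ((p * (+ 2 * + 2) + q * (+ 1 * + 1) + r * (+ 1 * + 1)) * + 1) +
           r * ((p * (+ 2 * + 1) + q * (+ 1 * + 1) + r * (+ 1 * + 1)) * + 1)) +
      r * (p * ((p * (+ 1 * + 1) + q * (+ 1 * + 2) + r * (+ 1 * + 1)) * + 1) +
           q * ((p * (+ 1 * + 2) + q * (+ 1 * + 1) + r * (+ 1 * + 1)) * + 1) +
           r * ((p * (+ 1 * + 1) + q * (+ 1 * + 1) + r * (+ 1 * + 1)) * + 1)) ≡
      (p + q + r) * (p + q + r) * (p + q + r) + + 9 * (p + q + r) * (p * q) + -[1+ 2 ] * (p * q) * r
    evaluate = solve-∀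

-- Both p and q are roots of (x - p′)(x - q′).
same-sum-product : ∀ {p q p′ q′} → p + q ≡ p′ + q′ → p * q ≡ p′ * q′ →
  (p ≡ p′ × q ≡ q′) ⊎ (p ≡ q′ × q ≡ p′)
same-sum-product {p} {q} {p′} {q′} sums products with ℤ.i*j≡0⇒i≡0∨j≡0 (p - p′) root
  where
  expand : ∀ p p′ q′ → (p - p′) * (p - q′) ≡ p * p - p * (p′ + q′) + p′ * q′
  expand = solve-∀
  cancel : ∀ p q → p * p - p * (p + q) + p * q ≡ 0ℤ
  cancel = solve-∀
  root : (p - p′) * (p - q′) ≡ 0ℤ
  root = trans (expand p p′ q′) (trans
    (cong₂ (λ s m → p * p - p * s + m) (sym sums) (sym products)) (cancel p q))
... | inj₁ p-p′ with refl ← ℤ.i-j≡0⇒i≡j p p′ p-p′ = inj₁ (refl , +-cancelˡ p sums)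
... | inj₂ p-q′ with refl ← ℤ.i-j≡0⇒i≡j p q′ p-q′ = inj₂ (refl , +-cancelˡ p (trans sums (ℤ.+-comm p′ p)))

-- From label counts and traces to isomorphism

relabel : Fin 3 → Fin 3
relabel 0ᶠ = 1ᶠ
relabel 1ᶠ = 0ᶠ
relabel 2ᶠ = 2ᶠ

relabel-block : ∀ c e → block (relabel c) (relabel e) ≡ block c e
relabel-block 0ᶠ 0ᶠ = refl
relabel-block 0ᶠ 1ᶠ = refl
relabel-block 0ᶠ 2ᶠ = refl
relabel-block 1ᶠ 0ᶠ = refl
relabel-block 1ᶠ 1ᶠ = refl
relabel-block 1ᶠ 2ᶠ = refl
relabel-block 2ᶠ 0ᶠ = refl
relabel-block 2ᶠ 1ᶠ = refl
relabel-block 2ᶠ 2ᶠ = refl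

count-relabel : ∀ {n} (ℓ : Fin n → Fin 3) c → count (relabel ∘ ℓ) c ≡ count ℓ (relabel c)
count-relabel {zero}  ℓ c = refl
count-relabel {suc n} ℓ c = cong₂ ℕ._+_ (δ-relabel (ℓ zero) c) (count-relabel (ℓ ∘ suc) c)
  where
  δ-relabel : ∀ e c → δ (relabel e) c ≡ δ e (relabel c)
  δ-relabel 0ᶠ 0ᶠ = refl
  δ-relabel 0ᶠ 1ᶠ = refl
  δ-relabel 0ᶠ 2ᶠ = refl
  δ-relabel 1ᶠ 0ᶠ = refl
  δ-relabel 1ᶠ 1ᶠ = refl
  δ-relabel 1ᶠ 2ᶠ = refl
  δ-relabel 2ᶠ 0ᶠ = refl
  δ-relabel 2ᶠ 1ᶠ = refl
  δ-relabel 2ᶠ 2ᶠ = refl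

-- Adjacent pairs have entry 1, but so does the diagonal; injectivity of `π` keeps the two apart.
same-entries⇒≅ : ∀ {n} {H G : ConnectedGraph n} (π : Perm.Permutation n n) →
  (∀ u v → shifted H u v ≡ shifted G (π Perm.⟨$⟩ʳ u) (π Perm.⟨$⟩ʳ v)) → H ≅ G
same-entries⇒≅ {H = H} {G} π entries = record
  { bijection = π
  ; adjacency = λ u v → mk⇔
      (λ e → transfer H G (entries u v) (λ eq → irreflexive H e (Injection.injective (↔⇒↣ π) eq)) e)
      (λ e → transfer G H (sym (entries u v)) (λ eq → irreflexive G e (cong (π Perm.⟨$⟩ʳ_) eq)) e)
  }
  where
  irreflexive : ∀ {n} (G : ConnectedGraph n) {u v} → ConnectedGraph._∼_ G u v → u ≢ v
  irreflexive G e refl = ConnectedGraph.∼-irrefl G e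
  transfer : ∀ {n} (G G′ : ConnectedGraph n) {u v u′ v′} → shifted G u v ≡ shifted G′ u′ v′ → u′ ≢ v′ →
    ConnectedGraph._∼_ G u v → ConnectedGraph._∼_ G′ u′ v′
  transfer G G′ eq u′≢v′ e = Distance.distance⇒adjacent G′ (ℤ.+-injective
    (trans (sym (Distance.shifted-off G′ u′≢v′)) (trans (sym eq)
      (Distance.shifted-entry G (Distance.adjacent⇒distance G e)))))

same-counts⇒≅ : ∀ {n} {H G : ConnectedGraph n} {ℓʰ ℓᵍ} → Labelling H ℓʰ → Labelling G ℓᵍ →
  (∀ c → count ℓʰ c ≡ count ℓᵍ c) → H ≅ G
same-counts⇒≅ {H = H} {G} {ℓʰ} {ℓᵍ} labʰ labᵍ same = let (π , labels) = matching ℓʰ ℓᵍ same in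
  same-entries⇒≅ {H = H} {G} π λ u v → trans (labʰ u v)
    (trans (sym (cong₂ block (labels u) (labels v))) (sym (labᵍ (π Perm.⟨$⟩ʳ u) (π Perm.⟨$⟩ʳ v))))

-- Extracting `r` from tr M³ divides by -3p′q′, which is why both labels must occur in `G`:
-- otherwise `G` is complete and tr M³ carries no information about `r`.
same-traces⇒≅ : ∀ {n} {H G : ConnectedGraph n} {ℓʰ ℓᵍ} → Labelling H ℓʰ → Labelling G ℓᵍ →
  count ℓᵍ 0ᶠ ≢ 0 → count ℓᵍ 1ᶠ ≢ 0 → SameTraces (shifted H) (shifted G) → H ≅ G
same-traces⇒≅ {n} {H} {G} {ℓʰ} {ℓᵍ} labʰ labᵍ p≢0 q≢0 same = conclude (same-sum-product sums products)
  where
  p = a₀ ℓʰ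
  q = a₁ ℓʰ
  r = a₂ ℓʰ
  p′ = a₀ ℓᵍ
  q′ = a₁ ℓᵍ
  r′ = a₂ ℓᵍ
  N = p + q + r
  orders : p′ + q′ + r′ ≡ N
  orders = trans (sym (order ℓᵍ)) (order ℓʰ)
  products : p * q ≡ p′ * q′
  products = ℤ.*-cancelˡ-≡ (+ 6) (p * q) (p′ * q′) (+-cancelˡ (N * N) (begin
    N * N + + 6 * (p * q)
      ≡⟨ trace-2 H labʰ ⟨
    tr (power⁺ (shifted H) 1)
      ≡⟨ same 1 ⟩
    tr (power⁺ (shifted G) 1)
      ≡⟨ trace-2 G labᵍ ⟩
    (p′ + q′ + r′) * (p′ + q′ + r′) + + 6 * (p′ * q′)
      ≡⟨ cong (λ N → N * N + + 6 * (p′ * q′)) orders ⟩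
    N * N + + 6 * (p′ * q′) ∎))
  m = p′ * q′
  m≢0 : m ≢ 0ℤ
  m≢0 m≡0 with ℤ.i*j≡0⇒i≡0∨j≡0 p′ m≡0
  ... | inj₁ p′≡0 = p≢0 (ℤ.+-injective p′≡0)
  ... | inj₂ q′≡0 = q≢0 (ℤ.+-injective q′≡0)
  remainders : r ≡ r′
  remainders = ℤ.*-cancelˡ-≡ m r r′ {{ℕ.≢-nonZero λ m≡0 → m≢0 (ℤ.∣i∣≡0⇒i≡0 m≡0)}}
    (ℤ.*-cancelˡ-≡ -[1+ 2 ] (m * r) (m * r′) (trans (sym (ℤ.*-assoc -[1+ 2 ] m r)) (trans
      (+-cancelˡ (N * N * N + + 9 * N * m) (begin
        N * N * N + + 9 * N * m + -[1+ 2 ] * m * r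
          ≡⟨ cong (λ m → N * N * N + + 9 * N * m + -[1+ 2 ] * m * r) products ⟨
        N * N * N + + 9 * N * (p * q) + -[1+ 2 ] * (p * q) * r
          ≡⟨ trace-3 H labʰ ⟨
        tr (power⁺ (shifted H) 2)
          ≡⟨ same 2 ⟩
        tr (power⁺ (shifted G) 2)
          ≡⟨ trace-3 G labᵍ ⟩
        (p′ + q′ + r′) * (p′ + q′ + r′) * (p′ + q′ + r′) + + 9 * (p′ + q′ + r′) * m + -[1+ 2 ] * m * r′
          ≡⟨ cong (λ N → N * N * N + + 9 * N * m + -[1+ 2 ] * m * r′) orders ⟩
        N * N * N + + 9 * N * m + -[1+ 2 ] * m * r′ ∎))
      (ℤ.*-assoc -[1+ 2 ] m r′))))
  sums : p + q ≡ p′ + q′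
  sums = +-cancelˡ r (trans (ℤ.+-comm r (p + q)) (trans (sym orders)
    (trans (ℤ.+-comm (p′ + q′) r′) (cong (_+ (p′ + q′)) (sym remainders)))))
  conclude : (p ≡ p′ × q ≡ q′) ⊎ (p ≡ q′ × q ≡ p′) → H ≅ G
  conclude (inj₁ (p≡p′ , q≡q′)) = same-counts⇒≅ {H = H} {G} labʰ labᵍ λ where
    0ᶠ → ℤ.+-injective p≡p′
    1ᶠ → ℤ.+-injective q≡q′
    2ᶠ → ℤ.+-injective remainders
  -- The two sides of `G` are interchanged, which `relabel` undoes without changing any entry.
  conclude (inj₂ (p≡q′ , q≡p′)) = same-counts⇒≅ {H = H} {G} labʰ
    (λ u v → trans (labᵍ u v) (sym (relabel-block (ℓᵍ u) (ℓᵍ v)))) λ where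
      0ᶠ → trans (ℤ.+-injective p≡q′) (sym (count-relabel ℓᵍ 0ᶠ))
      1ᶠ → trans (ℤ.+-injective q≡p′) (sym (count-relabel ℓᵍ 1ᶠ))
      2ᶠ → trans (ℤ.+-injective remainders) (sym (count-relabel ℓᵍ 2ᶠ))

-- The coalescence of two complete graphs

module _ (s t : ℕ) where
  open Coalescence s t using (V; InKₛ; InKₜ; cross)
  open Distance (K^ s t)

  ∉Kₛ⇒∈Kₜ : ∀ {i} → ¬ InKₛ i → InKₜ i
  ∉Kₛ⇒∈Kₜ i≮s = ℕ.m≤n⇒m≤1+n (ℕ.≮⇒≥ i≮s)

  ∉Kₜ⇒∈Kₛ : ∀ {i} → ¬ InKₜ i → InKₛ i
  ∉Kₜ⇒∈Kₛ s≰1+i = ℕ.<-trans (ℕ.n<1+n _) (ℕ.≰⇒> s≰1+i)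

  -- The decisions are arguments, so that `K-labelling` can split on them directly.
  classify : ∀ {A B : Set} → Dec A → Dec B → Fin 3
  classify (yes _) (yes _) = 2ᶠ
  classify (yes _) (no  _) = 0ᶠ
  classify (no  _) _       = 1ᶠ

  K-label : V → Fin 3
  K-label i = classify (toℕ i ℕ.<? s) (s ℕ.≤? suc (toℕ i))

  together : ∀ i j → (InKₛ i × InKₛ j) ⊎ (InKₜ i × InKₜ j) → shifted (K^ s t) i j ≡ + 1
  together i j e = by-cases (i ≟ᶠ j)
    where
    by-cases : Dec (i ≡ j) → shifted (K^ s t) i j ≡ + 1
    by-cases (yes refl) = shifted-diag i
    by-cases (no i≢j)   = shifted-entry (adjacent⇒distance (i≢j , e))

  apart : ∀ i j → ¬ InKₜ i → ¬ InKₛ j → shifted (K^ s t) i j ≡ + 2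
  apart i j i∉ j∉ = shifted-entry distance-2
    where
    distance-2 : d i j ≡ 2
    distance-2 with d i j in eq | cross i j (∉Kₜ⇒∈Kₛ {i} i∉) (∉Kₛ⇒∈Kₜ {j} j∉)
    ... | 0 | _ = contradiction (subst InKₜ (sym (distance-zero eq)) (∉Kₛ⇒∈Kₜ {j} j∉)) i∉
    ... | 1 | _ with distance⇒adjacent eq
    ...   | _ , inj₁ (_ , j∈) = contradiction j∈ j∉
    ...   | _ , inj₂ (i∈ , _) = contradiction i∈ i∉
    distance-2 | suc (suc k) | c , c∈ₛ , c∈ₜ = ℕ.≤-antisym
      (subst (_≤ 2) eq (distance-≤ {2} (c , ((λ { refl → i∉ c∈ₜ }) , inj₁ (∉Kₜ⇒∈Kₛ {i} i∉ , c∈ₛ)) ,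
                                        j , ((λ { refl → j∉ c∈ₛ }) , inj₂ (c∈ₜ , ∉Kₛ⇒∈Kₜ {j} j∉)) , refl)))
      (s≤s (s≤s z≤n))

  K-labelling : Labelling (K^ s t) K-label
  K-labelling i j = by-cases (toℕ i ℕ.<? s) (s ℕ.≤? suc (toℕ i)) (toℕ j ℕ.<? s) (s ℕ.≤? suc (toℕ j))
    where
    by-cases : (iₛ : Dec (InKₛ i)) (iₜ : Dec (InKₜ i)) (jₛ : Dec (InKₛ j)) (jₜ : Dec (InKₜ j)) →
      shifted (K^ s t) i j ≡ block (classify iₛ iₜ) (classify jₛ jₜ)
    by-cases (yes i∈ₛ) (yes _)   (yes j∈ₛ) (yes _)   = together i j (inj₁ (i∈ₛ , j∈ₛ))
    by-cases (yes i∈ₛ) (yes _)   (yes j∈ₛ) (no _)    = together i j (inj₁ (i∈ₛ , j∈ₛ))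
    by-cases (yes _)   (yes i∈ₜ) (no j∉ₛ)  _         = together i j (inj₂ (i∈ₜ , ∉Kₛ⇒∈Kₜ {j} j∉ₛ))
    by-cases (yes i∈ₛ) (no _)    (yes j∈ₛ) (yes _)   = together i j (inj₁ (i∈ₛ , j∈ₛ))
    by-cases (yes i∈ₛ) (no _)    (yes j∈ₛ) (no _)    = together i j (inj₁ (i∈ₛ , j∈ₛ))
    by-cases (yes _)   (no i∉ₜ)  (no j∉ₛ)  _         = apart i j i∉ₜ j∉ₛ
    by-cases (no i∉ₛ)  _         (yes _)   (yes j∈ₜ) = together i j (inj₂ (∉Kₛ⇒∈Kₜ {i} i∉ₛ , j∈ₜ))
    by-cases (no i∉ₛ)  _         (yes _)   (no j∉ₜ)  = trans (shifted-sym i j) (apart j i j∉ₜ i∉ₛ)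
    by-cases (no i∉ₛ)  _         (no j∉ₛ)  _         = together i j (inj₂ (∉Kₛ⇒∈Kₜ {i} i∉ₛ , ∉Kₛ⇒∈Kₜ {j} j∉ₛ))

  K-label-0 : ∀ i → ¬ InKₜ i → K-label i ≡ 0ᶠ
  K-label-0 i i∉ with toℕ i ℕ.<? s | s ℕ.≤? suc (toℕ i)
  ... | _      | yes i∈ = contradiction i∈ i∉
  ... | yes _  | no _   = refl
  ... | no i∉ₛ | no _   = contradiction (∉Kₛ⇒∈Kₜ {i} i∉ₛ) i∉

  K-label-1 : ∀ i → ¬ InKₛ i → K-label i ≡ 1ᶠ
  K-label-1 i i∉ with toℕ i ℕ.<? s | s ℕ.≤? suc (toℕ i)
  ... | yes i∈ | _ = contradiction i∈ i∉
  ... | no _   | _ = refl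

-- Vertex zero lies outside the copy of K_t, as s ≥ 2.
K-label-0-occurs : ∀ s t → 2 ≤ s → 2 ≤ t → count (K-label s t) 0ᶠ ≢ 0
K-label-0-occurs (suc zero)    t (s≤s ()) _
K-label-0-occurs (suc (suc s)) t _ _ =
  count-positive (K-label (suc (suc s)) t) {zero} (K-label-0 (suc (suc s)) t zero λ { (s≤s ()) })

-- The last vertex has index s + t - 2, which is at least s because t ≥ 2.
K-label-1-occurs : ∀ s t → 2 ≤ s → 2 ≤ t → count (K-label s t) 1ᶠ ≢ 0
K-label-1-occurs (suc zero)    t             (s≤s ()) _
K-label-1-occurs (suc (suc s)) (suc zero)    _ (s≤s ())
K-label-1-occurs (suc (suc s)) (suc (suc t)) _ _ =
  count-positive (K-label (suc (suc s)) (suc (suc t))) {fromℕ (s ℕ.+ suc (suc t))}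
    (K-label-1 (suc (suc s)) (suc (suc t)) (fromℕ (s ℕ.+ suc (suc t))) λ last<s →
      ℕ.<⇒≱ (subst (ℕ._< suc (suc s)) (Fin.toℕ-fromℕ (s ℕ.+ suc (suc t))) last<s)
        (subst (suc (suc s) ≤_) (sym (trans (ℕ.+-suc s (suc t)) (cong suc (ℕ.+-suc s t)))) (s≤s (s≤s (ℕ.m≤m+n s t)))))

theorem3p5 : ∀ {c ℓ₁ ℓ₂ : Level} (K : HeytingField c ℓ₁ ℓ₂) → CharacteristicZero K →
    ∀ (s t : ℕ) → 2 ≤ s → 2 ≤ t → DeterminedByDSpectrum K (K^ s t)
theorem3p5 K char-zero s t 2≤s 2≤t H cospectral
  -- Identifying the orders puts both graphs on the same vertex set, as `cospectral-traces`
  -- requires.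
  with refl ← cospectral-order K char-zero H (K^ s t) cospectral =
  same-traces⇒≅ {H = H} {K^ s t} (proj₂ labelling) (K-labelling s t)
    (K-label-0-occurs s t 2≤s 2≤t) (K-label-1-occurs s t 2≤s 2≤t) traces
  where
  traces : SameTraces (shifted H) (shifted (K^ s t))
  traces = cospectral-traces K char-zero H (K^ s t) cospectral
  -- The minors have size `suc k`, so the argument `3` selects the 4 × 4 ones.
  open Structure H (minors-vanish (Distance.shifted-sym H) (Distance.shifted-sym (K^ s t)) traces 3
    (labelling-rank (K^ s t) (K-labelling s t)))
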